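{- Let $(\mathcal C,\mathrm{Ty},\mathrm{Tm})$ be a category with families (with $\mathcal C$ small) supporting the usual type formers listed in the context. If $\mathcal C$ has exo-nat products, then in the presheaf two-level category with families $(\widehat{\mathcal C},\widehat{\mathrm{Ty}},\widehat{\mathrm{Tm}},\mathrm{Ty}^f,\mathrm{Tm}^f)$ built from $(\mathcal C,\mathrm{Ty},\mathrm{Tm})$, the natural number exo-type $\mathbb N^e\in\widehat{\mathrm{Ty}}(1_{\widehat{\mathcal C}})$ is a cofibrant exo-type.
   Context: **CwF.** A category with families (CwF) is a category $\mathcal C$ (objects: contexts) with a terminal object $1_{\mathcal C}$, a presheaf $\mathrm{Ty}:\mathcal C^{op}\to\mathrm{Set}$, a presheaf $\mathrm{Tm}:(\int\mathrm{Ty})^{op}\to\mathrm{Set}$, and for each $\Gamma$ and $A\in\mathrm{Ty}(\Gamma)$ a context $\Gamma.A$, a morphism $p_A:\Gamma.A\to\Gamma$ and a term $q_A\in\mathrm{Tm}(\Gamma.A,A[p_A])$ such that for all $\sigma:\Delta\to\Gamma$ and $a\in\mathrm{Tm}(\Delta,A[\sigma])$ there is a unique $\theta:\Delta\to\Gamma.A$ with $p_A\circ\theta=\sigma$ and $q_A[\theta]=a$. Here $X[\sigma]$ denotes the action of a presheaf on a morphism $\sigma$ (substitution). **Type formers.** The CwF is assumed to support, in the usual sense and strictly stably under substitution: $\Pi$-types (with $\beta,\eta$), $\Sigma$-types (with $\beta,\eta$), unit, empty type, coproducts, natural numbers, and intensional identity types $\mathrm{Id}$ (with $\mathrm{refl}$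 and $J$, and the $\beta$ rule for $J$). For a type $A\in \mathrm{Ty}(\Gamma)$, $\mathrm{isContr}(A):=\Sigma(A,\Pi(A[p_A],\mathrm{Id}_A))\in\mathrm{Ty}(\Gamma)$. **Exo-nat products.** Let $\mathbf N$ be the (external) set of natural numbers. $\mathcal C$ has exo-nat products if for each $\Gamma$ there is a map $\Omega_\Gamma:\prod_{\mathbf N}\mathrm{Ty}(\Gamma)\to\mathrm{Ty}(\Gamma)$ such that for any $Y=(Y_a)_{a\in\mathbf N}$: (1) there is a bijection $\phi:\mathrm{Tm}(\Gamma,\Omega_\Gamma(Y))\cong\prod_{a\in\mathbf N}\mathrm{Tm}(\Gamma,Y_a)$ with inverse $\psi$; (2) if $d,c\in\prod_{a\in\mathbf N}\mathrm{Tm}(\Gamma,Y_a)$ are such that for each $a$ there is a term of $\mathrm{Id}(d_a,c_a)$ (identity type of $Y_a$), then there is a term of $\mathrm{Id}(\psi(d),\psi(c))$ (identity type of $\Omega_\Gamma(Y)$); and all these data (the maps $\Omega_\Gamma$, the bijections, and the assignment of a term of $\mathrm{Id}(\psi(d),\psi(c))$ to terms of the $\mathrm{Id}(d_a,c_a)$) are natural in $\Gamma$, i.e. commute with substitution. **Two-level CwF.** A two-level CwF is a CwF $(\mathcal D,\mathrm{Ty}^e,\mathrm{Tm}^e)$ with a second presheaf $\mathrm{Ty}^f:\mathcal D^{op}\to\mathrm{Set}$ and a natural transformation $c:\mathrm{Ty}^f\to\mathrm{Ty}^e$. Then $\mathrm{Tm}^f(\Gamma,A):=\mathrm{Tm}^e(\Gamma,c_\Gamma(A))$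 and $\Gamma.A:=\Gamma.c_\Gamma(A)$ give a second CwF structure. Elements of $\mathrm{Ty}^e$ are exo-types, elements of $\mathrm{Ty}^f$ are types. **Presheaf two-level CwF.** Let $\widehat{\mathcal C}$ be the category of presheaves on $\mathcal C$. For $P\in\widehat{\mathcal C}$, $\widehat{\mathrm{Ty}}(P)$ is the set of presheaves $A:(\int P)^{op}\to\mathrm{Set}$ on the category of elements of $P$; for $\phi:Q\to P$, $A[\phi](\Gamma,x)=A(\Gamma,\phi_\Gamma(x))$; $\widehat{\mathrm{Tm}}(P,A)$ is the set of families $a(\Gamma,x)\in A(\Gamma,x)$ ($\Gamma\in\mathcal C$, $x\in P(\Gamma)$) with $a(\Gamma,x)[\sigma]=a(\Delta,x[\sigma])$ for all $\sigma:\Delta\to\Gamma$; and $P.A(\Gamma)=\coprod_{x\in P(\Gamma)}A(\Gamma,x)$. For $A\in\widehat{\mathrm{Ty}}(P)$ and $B\in\widehat{\mathrm{Ty}}(P.A)$, $\Pi^e(A,B)(\Gamma,x)$ is the set of families $f(\Delta,\sigma,a)\in B(\Delta,(x[\sigma],a))$, indexed by $\Delta\in\mathcal C$, $\sigma:\Delta\to\Gamma$, $a\in A(\Delta,x[\sigma])$, with $f(\Delta,\sigma,a)[\tau]=f(\Theta,\sigma\circ\tau,a[\tau])$ for all $\tau:\Theta\to\Delta$. The exo-type $\mathbb N^e\in\widehat{\mathrm{Ty}}(1_{\widehat{\mathcal C}})$ is the constant presheaf with value $\mathbf N$. The second level is $\mathrm{Ty}^f(P):=\widehat{\mathcal C}(P,\mathrm{Ty})$,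 with $c_P(A)(\Gamma,x):=\mathrm{Tm}(\Gamma,A_\Gamma(x))$ for $A\in\mathrm{Ty}^f(P)$, $x\in P(\Gamma)$, and $\mathrm{Tm}^f(P,A):=\widehat{\mathrm{Tm}}(P,c_P(A))$. The type formers of $(\mathcal C,\mathrm{Ty},\mathrm{Tm})$ are inherited pointwise by $(\mathrm{Ty}^f,\mathrm{Tm}^f)$; e.g. for $A\in\mathrm{Ty}^f(P)$, $B\in\mathrm{Ty}^f(P.A)$, $\Pi(A,B)_\Gamma(x)=\Pi\bigl(A_\Gamma(x),\,B_{\Gamma.A_\Gamma(x)}(x[p],q)\bigr)$, and similarly for $\Sigma$ and $\mathrm{Id}$; hence $\mathrm{isContr}$ makes sense for $\mathrm{Ty}^f$. **Cofibrant exo-type (semantic).** In a two-level CwF $(\mathcal D,\mathrm{Ty}^e,\mathrm{Tm}^e,\mathrm{Ty}^f,\mathrm{Tm}^f)$ with conversion $c$ and enough type formers, an exo-type $A\in\mathrm{Ty}^e(\Gamma)$ is cofibrant if for any $\Delta$ and $\sigma:\Delta\to\Gamma$: (1) there is a map, natural in $\Delta$, $\Theta^{\mathrm{Ty}}_\Delta:\mathrm{Ty}^f(\Delta.A[\sigma])\to\mathrm{Ty}^f(\Delta)$ such that for any $Y\in\mathrm{Ty}^f(\Delta.A[\sigma])$ there is an isomorphism, natural in $\Delta$, $c_\Delta(\Theta^{\mathrm{Ty}}_\Delta(Y))\cong\Pi^e(A[\sigma],c_{\Delta.A[\sigma]}(Y))$ of exo-types over $\Delta$; (2) there is a map, natural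 in $\Delta$, $\Theta^{\mathrm{Tm}}_\Delta:\mathrm{Tm}^f(\Delta.A[\sigma],\mathrm{isContr}(Y))\to\mathrm{Tm}^f(\Delta,\mathrm{isContr}(\Theta^{\mathrm{Ty}}_\Delta(Y)))$ for each such $Y$. Natural in $\Delta$ means compatible with substitution along every $\tau:\Upsilon\to\Delta$. -}

module Defs where

open import Level using (Level; _⊔_; Lift; lift; Setω) renaming (suc to lsuc)
open import Data.Nat.Base using (ℕ)
open import Data.Product using (Σ; Σ-syntax; ∃!; _×_; _,_; proj₁; proj₂)
open import Data.Unit.Polymorphic using (⊤; tt)
open import Function.Bundles using (_↔_; Inverse)
open import Relation.Binary.PropositionalEquality
  using (_≡_; refl; sym; trans; cong; cong₂; subst; module ≡-Reasoning)
open import Axiom.Extensionality.Propositional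
  using (Extensionality; implicit-extensionality)
open import Axiom.UniquenessOfIdentityProofs.WithK using (uip)

-- "Sets" are types with propositional equality.  Axiom K is on, so they
-- are h-sets; function extensionality is never built in, and is passed
-- as an argument to the constructions that need it.

record Category (o h : Level) : Set (lsuc (o ⊔ h)) where
  no-eta-equality
  infix  4 _⇒_
  infixr 9 _∘_
  field
    Ob    : Set o
    _⇒_   : Ob → Ob → Set h
    id    : ∀ {Γ} → Γ ⇒ Γ
    _∘_   : ∀ {Γ Δ Θ} → Δ ⇒ Γ → Θ ⇒ Δ → Θ ⇒ Γ
    idˡ   : ∀ {Γ Δ} (σ : Δ ⇒ Γ) → id ∘ σ ≡ σ
    idʳ   : ∀ {Γ Δ} (σ : Δ ⇒ Γ) → σ ∘ id ≡ σ
    assoc : ∀ {Γ Δ Θ Ξ} (σ : Δ ⇒ Γ) (τ : Θ ⇒ Δ) (υ : Ξ ⇒ Θ) →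
            (σ ∘ τ) ∘ υ ≡ σ ∘ (τ ∘ υ)

record Presheaf {o h : Level} (C : Category o h) (s : Level) : Set (o ⊔ h ⊔ lsuc s) where
  constructor mkPsh
  open Category C
  field
    F₀   : Ob → Set s
    F₁   : ∀ {Γ Δ} → Δ ⇒ Γ → F₀ Γ → F₀ Δ
    F-id : ∀ {Γ} (x : F₀ Γ) → F₁ id x ≡ x
    F-∘  : ∀ {Γ Δ Θ} (σ : Δ ⇒ Γ) (τ : Θ ⇒ Δ) (x : F₀ Γ) →
           F₁ (σ ∘ τ) x ≡ F₁ τ (F₁ σ x)

record NatTrans {o h s s′ : Level} {C : Category o h} (P : Presheaf C s) (Q : Presheaf C s′) :
                Set (o ⊔ h ⊔ s ⊔ s′) where
  constructor mkNat
  private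
    module P = Presheaf P
    module Q = Presheaf Q
  open Category C
  field
    η       : ∀ {Γ} → P.F₀ Γ → Q.F₀ Γ
    natural : ∀ {Γ Δ} (σ : Δ ⇒ Γ) (x : P.F₀ Γ) → Q.F₁ σ (η x) ≡ η (P.F₁ σ x)

opaque
  natural′ : ∀ {o h s s′} {C : Category o h} {P : Presheaf C s} {Q : Presheaf C s′}
             (φ : NatTrans P Q) {Γ Δ} (σ : Category._⇒_ C Δ Γ) {x : Presheaf.F₀ P Γ} {y} →
             Presheaf.F₁ P σ x ≡ y → Presheaf.F₁ Q σ (NatTrans.η φ x) ≡ NatTrans.η φ y
  natural′ φ σ e = trans (NatTrans.natural φ σ _) (cong (NatTrans.η φ) e)

Σ-≡ : ∀ {a b} {A : Set a} {B : A → Set b} {x y : A} {u : B x} {v : B y}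
      (e : x ≡ y) → subst B e u ≡ v → _≡_ {A = Σ A B} (x , u) (y , v)
Σ-≡ refl refl = refl

module _ {o h s : Level} {C : Category o h} (P : Presheaf C s) where
  open Category C
  open Presheaf P

  ∫Hom : Σ Ob F₀ → Σ Ob F₀ → Set (h ⊔ s)
  ∫Hom (Δ , y) (Γ , x) = Σ[ σ ∈ Δ ⇒ Γ ] F₁ σ x ≡ y

  ∫-≡ : ∀ {Y X : Σ Ob F₀} {f g : ∫Hom Y X} → proj₁ f ≡ proj₁ g → f ≡ g
  ∫-≡ {f = _ , e} {_ , e′} refl = cong (_ ,_) (uip e e′)

  ∫ : Category (o ⊔ s) (h ⊔ s)
  ∫ .Category.Ob          = Σ Ob F₀
  ∫ .Category._⇒_         = ∫Hom
  ∫ .Category.id          = id , F-id _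
  ∫ .Category._∘_ (σ , e) (τ , e′) = σ ∘ τ , trans (F-∘ σ τ _) (trans (cong (F₁ τ) e) e′)
  ∫ .Category.idˡ f       = ∫-≡ (idˡ _)
  ∫ .Category.idʳ f       = ∫-≡ (idʳ _)
  ∫ .Category.assoc f g k = ∫-≡ (assoc _ _ _)

module _ {o h s s′ r : Level} {C : Category o h} {P : Presheaf C s} {Q : Presheaf C s′}
         (φ : NatTrans P Q) (A : Presheaf (∫ Q) r) where
  open Category C
  private
    module P = Presheaf P
    module φ = NatTrans φ
    module A = Presheaf A

  private
    F₁ : ∀ {X Y} → ∫Hom P Y X → A.F₀ (proj₁ X , φ.η (proj₂ X)) → A.F₀ (proj₁ Y , φ.η (proj₂ Y))
    F₁ (σ , e) = A.F₁ (σ , natural′ φ σ e)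

    opaque
      F-id : ∀ {X} (a : A.F₀ (proj₁ X , φ.η (proj₂ X))) → F₁ (Category.id (∫ P) {X}) a ≡ a
      F-id a = trans (cong (λ f → A.F₁ f a) (∫-≡ Q refl)) (A.F-id a)

      F-∘ : ∀ {X Y Z} (f : ∫Hom P Y X) (g : ∫Hom P Z Y) (a : A.F₀ (proj₁ X , φ.η (proj₂ X))) →
            F₁ (Category._∘_ (∫ P) {X} {Y} {Z} f g) a ≡ F₁ {Y} {Z} g (F₁ {X} {Y} f a)
      F-∘ f g a = trans (cong (λ k → A.F₁ k a) (∫-≡ Q refl)) (A.F-∘ _ _ a)

  -- Precomposition with ∫P → ∫Q, (Γ , x) ↦ (Γ , φ(x)).
  reindex : Presheaf (∫ P) r
  reindex .Presheaf.F₀ (Γ , x)   = A.F₀ (Γ , φ.η x)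
  reindex .Presheaf.F₁ {X} {Y}   = F₁ {X} {Y}
  reindex .Presheaf.F-id {X}     = F-id {X}
  reindex .Presheaf.F-∘ {X} {Y} {Z} = F-∘ {X} {Y} {Z}

record CwF (o h t m : Level) : Set (lsuc (o ⊔ h ⊔ t ⊔ m)) where
  no-eta-equality
  infixl 5 _▹_
  infixl 8 _[_]
  field
    cat      : Category o h
  open Category cat public
  field
    𝟙        : Ob
    !        : ∀ Γ → Γ ⇒ 𝟙
    !-unique : ∀ {Γ} (σ : Γ ⇒ 𝟙) → ! Γ ≡ σ
    tyPsh    : Presheaf cat t
    tmPsh    : Presheaf (∫ tyPsh) m

  Ty : Ob → Set t
  Ty = Presheaf.F₀ tyPsh

  _[_] : ∀ {Γ Δ} → Ty Γ → Δ ⇒ Γ → Ty Δ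
  A [ σ ] = Presheaf.F₁ tyPsh σ A

  [id] : ∀ {Γ} (A : Ty Γ) → A [ id ] ≡ A
  [id] = Presheaf.F-id tyPsh

  [∘] : ∀ {Γ Δ Θ} (A : Ty Γ) (σ : Δ ⇒ Γ) (τ : Θ ⇒ Δ) → A [ σ ∘ τ ] ≡ A [ σ ] [ τ ]
  [∘] A σ τ = Presheaf.F-∘ tyPsh σ τ A

  Tm : ∀ Γ → Ty Γ → Set m
  Tm Γ A = Presheaf.F₀ tmPsh (Γ , A)

  -- A morphism (Δ , B) → (Γ , A) of ∫ Ty is a σ with A[σ] = B, so term
  -- substitution also absorbs type equalities: tmSub σ e a is "a[σ] : B".
  tmSub : ∀ {Γ Δ A B} (σ : Δ ⇒ Γ) → A [ σ ] ≡ B → Tm Γ A → Tm Δ B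
  tmSub σ e = Presheaf.F₁ tmPsh (σ , e)

  field
    _▹_ : ∀ Γ → Ty Γ → Ob
    p   : ∀ {Γ} (A : Ty Γ) → Γ ▹ A ⇒ Γ
    q   : ∀ {Γ} (A : Ty Γ) → Tm (Γ ▹ A) (A [ p A ])
    comprehension : ∀ {Γ Δ} (A : Ty Γ) (σ : Δ ⇒ Γ) (a : Tm Δ (A [ σ ])) →
      ∃! _≡_ λ (θ : Δ ⇒ Γ ▹ A) →
        Σ[ e ∈ p A ∘ θ ≡ σ ]
          tmSub θ (trans (sym ([∘] A (p A) θ)) (cong (A [_]) e)) (q A) ≡ a

  opaque
    -- ⟨σ , b⟩, for b in a type B equal to A[σ].
    ext : ∀ {Γ Δ} {A : Ty Γ} {B : Ty Δ} (σ : Δ ⇒ Γ) → A [ σ ] ≡ B → Tm Δ B → Δ ⇒ Γ ▹ A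
    ext {A = A} σ refl b = proj₁ (comprehension A σ b)

  ⟪_⟫ : ∀ {Γ} {A : Ty Γ} → Tm Γ A → Γ ⇒ Γ ▹ A
  ⟪_⟫ {A = A} = ext id ([id] A)

  opaque
    [∘p] : ∀ {Γ Δ} {A : Ty Γ} {A′ : Ty Δ} (σ : Δ ⇒ Γ) → A [ σ ] ≡ A′ → A [ σ ∘ p A′ ] ≡ A′ [ p A′ ]
    [∘p] {A = A} {A′} σ e = trans ([∘] A σ (p A′)) (cong (_[ p A′ ]) e)

  -- σ⁺ : Δ.A′ → Γ.A, for a type A′ equal to A[σ].
  lift⁺ : ∀ {Γ Δ} {A : Ty Γ} {A′ : Ty Δ} (σ : Δ ⇒ Γ) → A [ σ ] ≡ A′ → Δ ▹ A′ ⇒ Γ ▹ A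
  lift⁺ {A′ = A′} σ e = ext (σ ∘ p A′) ([∘p] σ e) (q A′)

  infixl 9 _⁺
  _⁺ : ∀ {Γ Δ} {A : Ty Γ} (σ : Δ ⇒ Γ) → Δ ▹ A [ σ ] ⇒ Γ ▹ A
  σ ⁺ = lift⁺ σ refl

  tmSub-id : ∀ {Γ A} (e : A [ id ] ≡ A) (a : Tm Γ A) → tmSub id e a ≡ a
  tmSub-id e a = trans (cong (λ f → Presheaf.F₁ tmPsh f a) (∫-≡ tyPsh refl))
                       (Presheaf.F-id tmPsh a)

  tmSub-∘ : ∀ {Γ Δ Θ A B D} {σ : Δ ⇒ Γ} {τ : Θ ⇒ Δ} (e₁ : A [ σ ] ≡ B) (e₂ : B [ τ ] ≡ D)
            (e : A [ σ ∘ τ ] ≡ D) (a : Tm Γ A) →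
            tmSub (σ ∘ τ) e a ≡ tmSub τ e₂ (tmSub σ e₁ a)
  tmSub-∘ e₁ e₂ e a = trans (cong (λ f → Presheaf.F₁ tmPsh f a) (∫-≡ tyPsh refl))
                            (Presheaf.F-∘ tmPsh _ _ a)

  tmSub-cong : ∀ {Γ Δ A B} {σ σ′ : Δ ⇒ Γ} {e : A [ σ ] ≡ B} {e′ : A [ σ′ ] ≡ B} {a a′ : Tm Γ A} →
               σ ≡ σ′ → a ≡ a′ → tmSub σ e a ≡ tmSub σ′ e′ a′
  tmSub-cong {a = a} refl refl = cong (λ f → Presheaf.F₁ tmPsh f a) (∫-≡ tyPsh refl)

  opaque
    unfolding ext

    p-ext : ∀ {Γ Δ} {A : Ty Γ} {B : Ty Δ} {σ : Δ ⇒ Γ} {e : A [ σ ] ≡ B} {b : Tm Δ B} →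
            p A ∘ ext σ e b ≡ σ
    p-ext {A = A} {σ = σ} {refl} {b} = proj₁ (proj₁ (proj₂ (comprehension A σ b)))

    q-ext : ∀ {Γ Δ} {A : Ty Γ} {B : Ty Δ} {σ : Δ ⇒ Γ} {e : A [ σ ] ≡ B} {b : Tm Δ B}
            (e′ : A [ p A ] [ ext σ e b ] ≡ B) → tmSub (ext σ e b) e′ (q A) ≡ b
    q-ext {A = A} {σ = σ} {refl} {b} e′ =
      trans (tmSub-cong refl refl) (proj₂ (proj₁ (proj₂ (comprehension A σ b))))

    ext-unique : ∀ {Γ Δ} {A : Ty Γ} {B : Ty Δ} {σ : Δ ⇒ Γ} {e : A [ σ ] ≡ B} {b : Tm Δ B}
                 (θ : Δ ⇒ Γ ▹ A) → p A ∘ θ ≡ σ → (e′ : A [ p A ] [ θ ] ≡ B) →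
                 tmSub θ e′ (q A) ≡ b → ext σ e b ≡ θ
    ext-unique {A = A} {σ = σ} {refl} {b} θ pθ e′ qθ =
      proj₂ (proj₂ (comprehension A σ b)) (pθ , trans (tmSub-cong refl refl) qθ)

  opaque
    ext-∘ : ∀ {Γ Δ Θ} {A : Ty Γ} {B D} {σ : Δ ⇒ Γ} {τ : Θ ⇒ Δ} {e : A [ σ ] ≡ B} {b : Tm Δ B}
            {e′ : A [ σ ∘ τ ] ≡ D} (e″ : B [ τ ] ≡ D) →
            ext σ e b ∘ τ ≡ ext (σ ∘ τ) e′ (tmSub τ e″ b)
    ext-∘ {A = A} {B} {σ = σ} {τ} {e} {b} e″ = sym (ext-unique (ext σ e b ∘ τ)
      (trans (sym (assoc _ _ _)) (cong (_∘ τ) p-ext))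
      (trans ([∘] _ _ τ) (trans (cong (_[ τ ]) eq) e″))
      (trans (tmSub-∘ eq e″ _ (q A)) (cong (tmSub τ e″) (q-ext eq))))
      where
      eq : A [ p A ] [ ext σ e b ] ≡ B
      eq = trans (sym ([∘] A (p A) (ext σ e b))) (trans (cong (A [_]) p-ext) e)

    ext-cong : ∀ {Γ Δ} {A : Ty Γ} {B} {σ σ′ : Δ ⇒ Γ} {e : A [ σ ] ≡ B} {e′ : A [ σ′ ] ≡ B}
               {b b′ : Tm Δ B} → σ ≡ σ′ → b ≡ b′ → ext σ e b ≡ ext σ′ e′ b′
    ext-cong {σ = σ} {e = e} {e′} {b} refl refl = cong (λ e → ext σ e b) (uip e e′)

    p-lift : ∀ {Γ Δ} {A : Ty Γ} {A′} {σ : Δ ⇒ Γ} {e : A [ σ ] ≡ A′} →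
             p A ∘ lift⁺ σ e ≡ σ ∘ p A′
    p-lift = p-ext

    lift-unique : ∀ {Γ Δ} (A : Ty Γ) (A′ : Ty Δ) (σ : Δ ⇒ Γ) (e : A [ σ ] ≡ A′)
                  (θ : Δ ▹ A′ ⇒ Γ ▹ A) → p A ∘ θ ≡ σ ∘ p A′ →
                  (e′ : A [ p A ] [ θ ] ≡ A′ [ p A′ ]) → tmSub θ e′ (q A) ≡ q A′ → lift⁺ σ e ≡ θ
    lift-unique A A′ σ e θ = ext-unique θ

    [p][lift] : ∀ {Γ Δ} {A : Ty Γ} {A′} {X : Ty Γ} {X′} {σ : Δ ⇒ Γ} {e : A [ σ ] ≡ A′} →
                X [ σ ] ≡ X′ → X [ p A ] [ lift⁺ σ e ] ≡ X′ [ p A′ ]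
    [p][lift] {X = X} refl = trans (sym ([∘] X _ _)) (trans (cong (X [_]) p-lift) ([∘] X _ _))

    [p][ext] : ∀ {Γ Δ} {A X : Ty Γ} {B X′} {σ : Δ ⇒ Γ} {e : A [ σ ] ≡ B} {b : Tm Δ B} →
               X [ σ ] ≡ X′ → X [ p A ] [ ext σ e b ] ≡ X′
    [p][ext] {X = X} e = trans (sym ([∘] X _ _)) (trans (cong (X [_]) p-ext) e)

    lift-∘-ext : ∀ {Γ Δ Θ} {A : Ty Γ} {A′} {B} {σ : Δ ⇒ Γ} {e : A [ σ ] ≡ A′} {τ : Θ ⇒ Δ}
                 {e′ : A′ [ τ ] ≡ B} {b : Tm Θ B} {e″ : A [ σ ∘ τ ] ≡ B} →
                 lift⁺ σ e ∘ ext τ e′ b ≡ ext (σ ∘ τ) e″ b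
    lift-∘-ext {A = A} {B = B} {σ = σ} {e} {τ} {e′} {b} {e″} = begin
      lift⁺ σ e ∘ ext τ e′ b  ≡⟨ ext-∘ {e′ = [e]} ([p][ext] e′) ⟩
      _                       ≡⟨ ext-cong eσ (q-ext _) ⟩
      ext (σ ∘ τ) e″ b        ∎
      where
      open ≡-Reasoning
      eσ : (σ ∘ p _) ∘ ext τ e′ b ≡ σ ∘ τ
      eσ = trans (assoc _ _ _) (cong (σ ∘_) p-ext)
      [e] : A [ (σ ∘ p _) ∘ ext τ e′ b ] ≡ B
      [e] = trans (cong (A [_]) eσ) e″

    weaken-ext : ∀ {Γ Δ} {A X : Ty Γ} {B X′} {σ : Δ ⇒ Γ} {e : A [ σ ] ≡ B} {b : Tm Δ B} {a : Tm Γ X}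
                 (e₁ : X [ σ ] ≡ X′) (e₂ : X [ p A ] [ ext σ e b ] ≡ X′) →
                 tmSub (ext σ e b) e₂ (tmSub (p A) refl a) ≡ tmSub σ e₁ a
    weaken-ext {X = X} {a = a} e₁ e₂ =
      trans (sym (tmSub-∘ refl e₂ (trans ([∘] X _ _) e₂) a)) (tmSub-cong p-ext refl)

    weaken-lift : ∀ {Γ Δ} {A X : Ty Γ} {A′ X′} {σ : Δ ⇒ Γ} {e : A [ σ ] ≡ A′}
                  {a : Tm Γ X} {a′ : Tm Δ X′} (e₁ : X [ σ ] ≡ X′)
                  (e₂ : X [ p A ] [ lift⁺ σ e ] ≡ X′ [ p A′ ]) → tmSub σ e₁ a ≡ a′ →
                  tmSub (lift⁺ σ e) e₂ (tmSub (p A) refl a) ≡ tmSub (p A′) refl a′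
    weaken-lift {X = X} {A′} {σ = σ} {a = a} refl e₂ refl =
      trans (weaken-ext ([∘] X σ (p A′)) e₂) (tmSub-∘ refl refl ([∘] X σ (p A′)) a)

    ⟪⟫-natural : ∀ {Γ Δ} {A : Ty Γ} {A′} {σ : Δ ⇒ Γ} {a : Tm Γ A} {a′ : Tm Δ A′}
                 (e : A [ σ ] ≡ A′) → tmSub σ e a ≡ a′ → ⟪ a ⟫ ∘ σ ≡ lift⁺ σ e ∘ ⟪ a′ ⟫
    ⟪⟫-natural {A = A} {σ = σ} {a} {a′} e ea = begin
      ⟪ a ⟫ ∘ σ                            ≡⟨ ext-∘ {e′ = trans (cong (A [_]) (idˡ σ)) e} e ⟩
      ext (id ∘ σ) _ (tmSub σ e a)         ≡⟨ ext-cong (trans (idˡ σ) (sym (idʳ σ))) ea ⟩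
      ext (σ ∘ id) (trans (cong (A [_]) (idʳ σ)) e) a′  ≡⟨ lift-∘-ext ⟨
      lift⁺ σ e ∘ ⟪ a′ ⟫                   ∎
      where open ≡-Reasoning

    ext-p-natural :
      ∀ {Γ Δ} {A B : Ty Γ} {A′ B′} {X X′} {σ : Δ ⇒ Γ} {eA : A [ σ ] ≡ A′} {eB : B [ σ ] ≡ B′}
      {e : B [ p A ] ≡ X} {e′ : B′ [ p A′ ] ≡ X′} {t : Tm (Γ ▹ A) X} {t′ : Tm (Δ ▹ A′) X′}
      (eX : X [ lift⁺ σ eA ] ≡ X′) → tmSub (lift⁺ σ eA) eX t ≡ t′ →
      ext (p A) e t ∘ lift⁺ σ eA ≡ lift⁺ σ eB ∘ ext (p A′) e′ t′
    ext-p-natural {A = A} {B} {A′} {X′ = X′} {σ = σ} {eA} {eB} {e} {e′} {t} {t′} eX et = begin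
      ext (p A) e t ∘ lift⁺ σ eA  ≡⟨ ext-∘ {e′ = trans (cong (B [_]) p-lift) e₀} eX ⟩
      _                           ≡⟨ ext-cong p-lift et ⟩
      ext (σ ∘ p A′) e₀ t′        ≡⟨ lift-∘-ext ⟨
      lift⁺ σ eB ∘ ext (p A′) e′ t′  ∎
      where
      open ≡-Reasoning
      e₀ : B [ σ ∘ p A′ ] ≡ X′
      e₀ = trans ([∘] B σ (p A′)) (trans (cong (_[ p A′ ]) eB) e′)

    [⟪⟫]-natural : ∀ {Γ Δ} {A : Ty Γ} {A′} (B : Ty (Γ ▹ A)) {σ : Δ ⇒ Γ} {a : Tm Γ A} {a′ : Tm Δ A′}
                   (e : A [ σ ] ≡ A′) → tmSub σ e a ≡ a′ →
                   B [ ⟪ a ⟫ ] [ σ ] ≡ B [ lift⁺ σ e ] [ ⟪ a′ ⟫ ]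
    [⟪⟫]-natural B e ea =
      trans (sym ([∘] B _ _)) (trans (cong (B [_]) (⟪⟫-natural e ea)) ([∘] B _ _))

-- For Π, Σ and Id the formation rule is a record of its own: this is all
-- that isContr and the definition of cofibrancy mention.

module _ {o h t m : Level} (C : CwF o h t m) where
  open CwF C

  record ΠFormer : Set (o ⊔ h ⊔ t) where
    field
      Π    : ∀ {Γ} (A : Ty Γ) → Ty (Γ ▹ A) → Ty Γ
      Π-[] : ∀ {Γ Δ} {A : Ty Γ} {B : Ty (Γ ▹ A)} (σ : Δ ⇒ Γ) →
             Π A B [ σ ] ≡ Π (A [ σ ]) (B [ σ ⁺ ])

    opaque
      Π-[]′ : ∀ {Γ Δ} {A : Ty Γ} {A′} {B : Ty (Γ ▹ A)} {B′} (σ : Δ ⇒ Γ) (e : A [ σ ] ≡ A′) →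
              B [ lift⁺ σ e ] ≡ B′ → Π A B [ σ ] ≡ Π A′ B′
      Π-[]′ σ refl refl = Π-[] σ

  record ΣFormer : Set (o ⊔ h ⊔ t) where
    field
      Sg    : ∀ {Γ} (A : Ty Γ) → Ty (Γ ▹ A) → Ty Γ
      Sg-[] : ∀ {Γ Δ} {A : Ty Γ} {B : Ty (Γ ▹ A)} (σ : Δ ⇒ Γ) →
              Sg A B [ σ ] ≡ Sg (A [ σ ]) (B [ σ ⁺ ])

    opaque
      Sg-[]′ : ∀ {Γ Δ} {A : Ty Γ} {A′} {B : Ty (Γ ▹ A)} {B′} (σ : Δ ⇒ Γ) (e : A [ σ ] ≡ A′) →
               B [ lift⁺ σ e ] ≡ B′ → Sg A B [ σ ] ≡ Sg A′ B′
      Sg-[]′ σ refl refl = Sg-[] σ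

  record IdFormer : Set (o ⊔ h ⊔ t ⊔ m) where
    field
      Id    : ∀ {Γ} (A : Ty Γ) → Tm Γ A → Tm Γ A → Ty Γ
      Id-[] : ∀ {Γ Δ} {A : Ty Γ} {a b : Tm Γ A} (σ : Δ ⇒ Γ) →
              Id A a b [ σ ] ≡ Id (A [ σ ]) (tmSub σ refl a) (tmSub σ refl b)

    opaque
      Id-[]′ : ∀ {Γ Δ} {A : Ty Γ} {A′} {a b : Tm Γ A} {a′ b′} (σ : Δ ⇒ Γ) (e : A [ σ ] ≡ A′) →
               tmSub σ e a ≡ a′ → tmSub σ e b ≡ b′ → Id A a b [ σ ] ≡ Id A′ a′ b′
      Id-[]′ σ refl refl refl = Id-[] σ

    -- The identity type of A as a family over Γ.A.A[p].
    IdFam : ∀ {Γ} (A : Ty Γ) → Ty (Γ ▹ A ▹ A [ p A ])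
    IdFam A = Id (A [ p A ] [ p (A [ p A ]) ]) (tmSub (p (A [ p A ])) refl (q A)) (q (A [ p A ]))

    lift² : ∀ {Γ Δ} {A : Ty Γ} {A′} (σ : Δ ⇒ Γ) → A [ σ ] ≡ A′ →
            Δ ▹ A′ ▹ A′ [ p A′ ] ⇒ Γ ▹ A ▹ A [ p A ]
    lift² σ e = lift⁺ (lift⁺ σ e) ([p][lift] e)

    opaque
      IdFam-[] : ∀ {Γ Δ} {A : Ty Γ} {A′} (σ : Δ ⇒ Γ) (e : A [ σ ] ≡ A′) →
                 IdFam A [ lift² σ e ] ≡ IdFam A′
      IdFam-[] {A = A} {A′} σ e =
        Id-[]′ (lift² σ e) e₂ (weaken-lift e₁ e₂ (q-ext e₁)) (q-ext e₂)
        where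
        e₁ : A [ p A ] [ lift⁺ σ e ] ≡ A′ [ p A′ ]
        e₁ = [p][lift] e
        e₂ : A [ p A ] [ p (A [ p A ]) ] [ lift² σ e ] ≡ A′ [ p A′ ] [ p (A′ [ p A′ ]) ]
        e₂ = [p][lift] e₁

  record ΠTypes : Set (o ⊔ h ⊔ t ⊔ m) where
    field
      former : ΠFormer
    open ΠFormer former public
    field
      -- to = application, from = abstraction; the inverse laws are β and η.
      curry    : ∀ {Γ} {A : Ty Γ} {B : Ty (Γ ▹ A)} → Tm Γ (Π A B) ↔ Tm (Γ ▹ A) B

    app : ∀ {Γ} {A : Ty Γ} {B : Ty (Γ ▹ A)} → Tm Γ (Π A B) → Tm (Γ ▹ A) B
    app = Inverse.to curry

    lam : ∀ {Γ} {A : Ty Γ} {B : Ty (Γ ▹ A)} → Tm (Γ ▹ A) B → Tm Γ (Π A B)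
    lam = Inverse.from curry

    field
      lam-[] : ∀ {Γ Δ} {A : Ty Γ} {B : Ty (Γ ▹ A)} (σ : Δ ⇒ Γ) (b : Tm (Γ ▹ A) B) →
               tmSub σ (Π-[] σ) (lam b) ≡ lam (tmSub (σ ⁺) refl b)

  record ΣTypes : Set (o ⊔ h ⊔ t ⊔ m) where
    field
      former : ΣFormer
    open ΣFormer former public
    field
      -- to = projections, from = pairing; the inverse laws are β and η.
      split    : ∀ {Γ} {A : Ty Γ} {B : Ty (Γ ▹ A)} →
                 Tm Γ (Sg A B) ↔ (Σ[ a ∈ Tm Γ A ] Tm Γ (B [ ⟪ a ⟫ ]))

    pair : ∀ {Γ} {A : Ty Γ} {B : Ty (Γ ▹ A)} (a : Tm Γ A) → Tm Γ (B [ ⟪ a ⟫ ]) → Tm Γ (Sg A B)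
    pair a b = Inverse.from split (a , b)

    field
      pair-[] : ∀ {Γ Δ} {A : Ty Γ} {B : Ty (Γ ▹ A)} (σ : Δ ⇒ Γ)
                (a : Tm Γ A) (b : Tm Γ (B [ ⟪ a ⟫ ])) →
                tmSub σ (Sg-[] σ) (pair a b) ≡
                pair (tmSub σ refl a) (tmSub σ ([⟪⟫]-natural B refl refl) b)

  record UnitType : Set (o ⊔ h ⊔ t ⊔ m) where
    field
      Unit    : ∀ {Γ} → Ty Γ
      Unit-[] : ∀ {Γ Δ} (σ : Δ ⇒ Γ) → Unit [ σ ] ≡ Unit
      ⋆       : ∀ {Γ} → Tm Γ Unit
      ⋆-[]    : ∀ {Γ Δ} (σ : Δ ⇒ Γ) → tmSub σ (Unit-[] σ) ⋆ ≡ ⋆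
      elim    : ∀ {Γ} (D : Ty (Γ ▹ Unit)) → Tm Γ (D [ ⟪ ⋆ ⟫ ]) → Tm (Γ ▹ Unit) D
      elim-β  : ∀ {Γ} (D : Ty (Γ ▹ Unit)) (d : Tm Γ (D [ ⟪ ⋆ ⟫ ])) →
                tmSub ⟪ ⋆ ⟫ refl (elim D d) ≡ d
      elim-[] : ∀ {Γ Δ} (σ : Δ ⇒ Γ) (D : Ty (Γ ▹ Unit)) (d : Tm Γ (D [ ⟪ ⋆ ⟫ ])) →
                let σ⁺ = lift⁺ σ (Unit-[] σ) in
                tmSub σ⁺ refl (elim D d) ≡
                elim (D [ σ⁺ ]) (tmSub σ ([⟪⟫]-natural D (Unit-[] σ) (⋆-[] σ)) d)

  record EmptyType : Set (o ⊔ h ⊔ t ⊔ m) where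
    field
      Empty    : ∀ {Γ} → Ty Γ
      Empty-[] : ∀ {Γ Δ} (σ : Δ ⇒ Γ) → Empty [ σ ] ≡ Empty
      elim     : ∀ {Γ} (D : Ty (Γ ▹ Empty)) → Tm (Γ ▹ Empty) D
      elim-[]  : ∀ {Γ Δ} (σ : Δ ⇒ Γ) (D : Ty (Γ ▹ Empty)) →
                 let σ⁺ = lift⁺ σ (Empty-[] σ) in
                 tmSub σ⁺ refl (elim D) ≡ elim (D [ σ⁺ ])

  record CoproductIntro : Set (o ⊔ h ⊔ t ⊔ m) where
    infixr 6 _⊕_
    field
      _⊕_    : ∀ {Γ} → Ty Γ → Ty Γ → Ty Γ
      ⊕-[]   : ∀ {Γ Δ} {A B : Ty Γ} (σ : Δ ⇒ Γ) → (A ⊕ B) [ σ ] ≡ A [ σ ] ⊕ B [ σ ]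
      inl    : ∀ {Γ} {A B : Ty Γ} → Tm Γ A → Tm Γ (A ⊕ B)
      inr    : ∀ {Γ} {A B : Ty Γ} → Tm Γ B → Tm Γ (A ⊕ B)
      inl-[] : ∀ {Γ Δ} {A B : Ty Γ} (σ : Δ ⇒ Γ) (a : Tm Γ A) →
               tmSub σ (⊕-[] σ) (inl {B = B} a) ≡ inl (tmSub σ refl a)
      inr-[] : ∀ {Γ Δ} {A B : Ty Γ} (σ : Δ ⇒ Γ) (b : Tm Γ B) →
               tmSub σ (⊕-[] σ) (inr {A = A} b) ≡ inr (tmSub σ refl b)

    inlₛ : ∀ {Γ} (A B : Ty Γ) → Γ ▹ A ⇒ Γ ▹ (A ⊕ B)
    inlₛ A B = ext (p A) (⊕-[] (p A)) (inl (q A))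

    inrₛ : ∀ {Γ} (A B : Ty Γ) → Γ ▹ B ⇒ Γ ▹ (A ⊕ B)
    inrₛ A B = ext (p B) (⊕-[] (p B)) (inr (q B))

    private
      inl-[]′ : ∀ {Γ Δ} {A B : Ty Γ} {A′ B′} (σ : Δ ⇒ Γ) (eA : A [ σ ] ≡ A′) (eB : B [ σ ] ≡ B′)
                {a a′} → tmSub σ eA a ≡ a′ →
                tmSub σ (trans (⊕-[] σ) (cong₂ _⊕_ eA eB)) (inl a) ≡ inl a′
      inl-[]′ σ refl refl refl = trans (tmSub-cong refl refl) (inl-[] σ _)

      inr-[]′ : ∀ {Γ Δ} {A B : Ty Γ} {A′ B′} (σ : Δ ⇒ Γ) (eA : A [ σ ] ≡ A′) (eB : B [ σ ] ≡ B′)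
                {b b′} → tmSub σ eB b ≡ b′ →
                tmSub σ (trans (⊕-[] σ) (cong₂ _⊕_ eA eB)) (inr b) ≡ inr b′
      inr-[]′ σ refl refl refl = trans (tmSub-cong refl refl) (inr-[] σ _)

    opaque
      [inlₛ]-natural : ∀ {Γ Δ} {A B : Ty Γ} (D : Ty (Γ ▹ (A ⊕ B))) (σ : Δ ⇒ Γ) →
        D [ inlₛ A B ] [ σ ⁺ ] ≡ D [ lift⁺ σ (⊕-[] σ) ] [ inlₛ (A [ σ ]) (B [ σ ]) ]
      [inlₛ]-natural D σ = trans (sym ([∘] D _ _)) (trans
        (cong (D [_]) (ext-p-natural _ (inl-[]′ (σ ⁺) ([p][lift] refl) ([p][lift] refl) (q-ext _))))
        ([∘] D _ _))

      [inrₛ]-natural : ∀ {Γ Δ} {A B : Ty Γ} (D : Ty (Γ ▹ (A ⊕ B))) (σ : Δ ⇒ Γ) →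
        D [ inrₛ A B ] [ σ ⁺ ] ≡ D [ lift⁺ σ (⊕-[] σ) ] [ inrₛ (A [ σ ]) (B [ σ ]) ]
      [inrₛ]-natural D σ = trans (sym ([∘] D _ _)) (trans
        (cong (D [_]) (ext-p-natural _ (inr-[]′ (σ ⁺) ([p][lift] refl) ([p][lift] refl) (q-ext _))))
        ([∘] D _ _))

  record Coproducts : Set (o ⊔ h ⊔ t ⊔ m) where
    field
      intro : CoproductIntro
    open CoproductIntro intro public
    field
      case    : ∀ {Γ} {A B : Ty Γ} (D : Ty (Γ ▹ (A ⊕ B))) →
                Tm (Γ ▹ A) (D [ inlₛ A B ]) → Tm (Γ ▹ B) (D [ inrₛ A B ]) → Tm (Γ ▹ (A ⊕ B)) D
      case-βˡ : ∀ {Γ} {A B : Ty Γ} (D : Ty (Γ ▹ (A ⊕ B))) l r →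
                tmSub (inlₛ A B) refl (case D l r) ≡ l
      case-βʳ : ∀ {Γ} {A B : Ty Γ} (D : Ty (Γ ▹ (A ⊕ B))) l r →
                tmSub (inrₛ A B) refl (case D l r) ≡ r
      case-[] : ∀ {Γ Δ} {A B : Ty Γ} (σ : Δ ⇒ Γ) (D : Ty (Γ ▹ (A ⊕ B))) l r →
                let σ⁺ = lift⁺ σ (⊕-[] σ) in
                tmSub σ⁺ refl (case D l r) ≡
                case (D [ σ⁺ ]) (tmSub (σ ⁺) ([inlₛ]-natural D σ) l)
                                (tmSub (σ ⁺) ([inrₛ]-natural D σ) r)

  record NatIntro : Set (o ⊔ h ⊔ t ⊔ m) where
    field
      Nat     : ∀ {Γ} → Ty Γ
      Nat-[]  : ∀ {Γ Δ} (σ : Δ ⇒ Γ) → Nat [ σ ] ≡ Nat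
      ze      : ∀ {Γ} → Tm Γ Nat
      ze-[]   : ∀ {Γ Δ} (σ : Δ ⇒ Γ) → tmSub σ (Nat-[] σ) ze ≡ ze
      su      : ∀ {Γ} → Tm Γ Nat → Tm Γ Nat
      su-[]   : ∀ {Γ Δ} (σ : Δ ⇒ Γ) (n : Tm Γ Nat) →
                tmSub σ (Nat-[] σ) (su n) ≡ su (tmSub σ (Nat-[] σ) n)

    suₛ : ∀ {Γ} → Γ ▹ Nat ⇒ Γ ▹ Nat
    suₛ = ext (p Nat) (Nat-[] _) (su (subst (Tm _) (Nat-[] _) (q Nat)))

    private
      q-natural : ∀ {Γ Δ} (σ : Δ ⇒ Γ) {X X′} (eX : Nat [ p Nat ] ≡ X) (eX′ : Nat [ p Nat ] ≡ X′)
                  (e : X [ lift⁺ σ (Nat-[] σ) ] ≡ X′) →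
                  tmSub (lift⁺ σ (Nat-[] σ)) e (subst (Tm _) eX (q Nat)) ≡ subst (Tm _) eX′ (q Nat)
      q-natural σ refl refl e = q-ext e

    opaque
      suₛ-natural : ∀ {Γ Δ} (σ : Δ ⇒ Γ) →
                    suₛ ∘ lift⁺ σ (Nat-[] σ) ≡ lift⁺ σ (Nat-[] σ) ∘ suₛ
      suₛ-natural σ = ext-p-natural (Nat-[] _)
        (trans (su-[] _ _) (cong su (q-natural σ (Nat-[] _) (Nat-[] _) (Nat-[] _))))

      [suₛ]-natural : ∀ {Γ Δ} (D : Ty (Γ ▹ Nat)) (σ : Δ ⇒ Γ) → let σ⁺ = lift⁺ σ (Nat-[] σ) in
                      D [ suₛ ∘ p D ] [ σ⁺ ⁺ ] ≡ D [ σ⁺ ] [ suₛ ∘ p (D [ σ⁺ ]) ]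
      [suₛ]-natural D σ = trans (sym ([∘] D _ _)) (trans (cong (D [_]) (begin
          (suₛ ∘ p D) ∘ (lift⁺ σ _ ⁺)  ≡⟨ assoc _ _ _ ⟩
          suₛ ∘ (p D ∘ (lift⁺ σ _ ⁺))  ≡⟨ cong (suₛ ∘_) p-lift ⟩
          suₛ ∘ (lift⁺ σ _ ∘ p _)      ≡⟨ assoc _ _ _ ⟨
          (suₛ ∘ lift⁺ σ _) ∘ p _      ≡⟨ cong (_∘ p _) (suₛ-natural σ) ⟩
          (lift⁺ σ _ ∘ suₛ) ∘ p _      ≡⟨ assoc _ _ _ ⟩
          lift⁺ σ _ ∘ (suₛ ∘ p _)      ∎)) ([∘] D _ _))
        where open ≡-Reasoning

      [suₛ]-β : ∀ {Γ} (D : Ty (Γ ▹ Nat)) (d : Tm (Γ ▹ Nat) D) →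
                D [ suₛ ∘ p D ] [ ⟪ d ⟫ ] ≡ D [ suₛ ]
      [suₛ]-β D d = trans (sym ([∘] D _ _))
        (cong (D [_]) (trans (assoc _ _ _) (trans (cong (suₛ ∘_) p-ext) (idʳ _))))

  record NatType : Set (o ⊔ h ⊔ t ⊔ m) where
    field
      intro : NatIntro
    open NatIntro intro public
    field
      rec    : ∀ {Γ} (D : Ty (Γ ▹ Nat)) → Tm Γ (D [ ⟪ ze ⟫ ]) →
               Tm (Γ ▹ Nat ▹ D) (D [ suₛ ∘ p D ]) → Tm (Γ ▹ Nat) D
      rec-βz : ∀ {Γ} (D : Ty (Γ ▹ Nat)) z s → tmSub ⟪ ze ⟫ refl (rec D z s) ≡ z
      rec-βs : ∀ {Γ} (D : Ty (Γ ▹ Nat)) z s →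
               tmSub suₛ refl (rec D z s) ≡ tmSub ⟪ rec D z s ⟫ ([suₛ]-β D (rec D z s)) s
      rec-[] : ∀ {Γ Δ} (σ : Δ ⇒ Γ) (D : Ty (Γ ▹ Nat)) z s → let σ⁺ = lift⁺ σ (Nat-[] σ) in
               tmSub σ⁺ refl (rec D z s) ≡
               rec (D [ σ⁺ ]) (tmSub σ ([⟪⟫]-natural D (Nat-[] σ) (ze-[] σ)) z)
                              (tmSub (σ⁺ ⁺) ([suₛ]-natural D σ) s)

  record IdIntro : Set (o ⊔ h ⊔ t ⊔ m) where
    field
      former : IdFormer
    open IdFormer former public
    field
      rfl    : ∀ {Γ} {A : Ty Γ} (a : Tm Γ A) → Tm Γ (Id A a a)
      rfl-[] : ∀ {Γ Δ} {A : Ty Γ} (σ : Δ ⇒ Γ) (a : Tm Γ A) →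
               tmSub σ (Id-[] σ) (rfl a) ≡ rfl (tmSub σ refl a)

    private
      rfl-[]′ : ∀ {Γ Δ} {A : Ty Γ} {A′} (σ : Δ ⇒ Γ) (e : A [ σ ] ≡ A′) {a a′}
                (ea : tmSub σ e a ≡ a′) → tmSub σ (Id-[]′ σ e ea ea) (rfl a) ≡ rfl a′
      rfl-[]′ σ refl refl = trans (tmSub-cong refl refl) (rfl-[] σ _)

    opaque
      IdFam-diag : ∀ {Γ} (A : Ty Γ) → IdFam A [ ⟪ q A ⟫ ] ≡ Id (A [ p A ]) (q A) (q A)
      IdFam-diag A = Id-[]′ ⟪ q A ⟫ e
        (trans (weaken-ext ([id] _) e) (tmSub-id ([id] _) (q A)))
        (q-ext e)
        where
        e : A [ p A ] [ p (A [ p A ]) ] [ ⟪ q A ⟫ ] ≡ A [ p A ]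
        e = [p][ext] ([id] _)

    -- ⟨⟨id , q⟩ , refl q⟩ : Γ.A → Γ.A.A[p].Id_A
    rflₛ : ∀ {Γ} (A : Ty Γ) → Γ ▹ A ⇒ Γ ▹ A ▹ A [ p A ] ▹ IdFam A
    rflₛ A = ext ⟪ q A ⟫ (IdFam-diag A) (rfl (q A))

    lift³ : ∀ {Γ Δ} {A : Ty Γ} (σ : Δ ⇒ Γ) →
            Δ ▹ A [ σ ] ▹ A [ σ ] [ p (A [ σ ]) ] ▹ IdFam (A [ σ ]) ⇒
            Γ ▹ A ▹ A [ p A ] ▹ IdFam A
    lift³ σ = lift⁺ (lift² σ refl) (IdFam-[] σ refl)

    opaque
      rflₛ-natural : ∀ {Γ Δ} {A : Ty Γ} (σ : Δ ⇒ Γ) →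
                     rflₛ A ∘ (σ ⁺) ≡ lift³ σ ∘ rflₛ (A [ σ ])
      rflₛ-natural {A = A} σ = begin
        rflₛ A ∘ (σ ⁺)
          ≡⟨ ext-∘ {e′ = trans (cong (IdFam A [_]) eq) e₀} (Id-[]′ (σ ⁺) eA (q-ext eA) (q-ext eA)) ⟩
        ext (⟪ q A ⟫ ∘ (σ ⁺)) _ (tmSub (σ ⁺) _ (rfl (q A)))
          ≡⟨ ext-cong eq (rfl-[]′ (σ ⁺) eA (q-ext eA)) ⟩
        ext (lift² σ refl ∘ ⟪ q (A [ σ ]) ⟫) e₀ (rfl (q (A [ σ ])))
          ≡⟨ lift-∘-ext ⟨
        lift³ σ ∘ rflₛ (A [ σ ]) ∎
        where
        open ≡-Reasoning
        eA : A [ p A ] [ σ ⁺ ] ≡ A [ σ ] [ p (A [ σ ]) ]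
        eA = [p][lift] {A = A} {X = A} {σ = σ} {e = refl} refl
        eq : ⟪ q A ⟫ ∘ (σ ⁺) ≡ lift² σ refl ∘ ⟪ q (A [ σ ]) ⟫
        eq = ⟪⟫-natural {σ = σ ⁺} {a = q A} {a′ = q (A [ σ ])} eA (q-ext eA)
        e₀ : IdFam A [ lift² σ refl ∘ ⟪ q (A [ σ ]) ⟫ ] ≡
             Id (A [ σ ] [ p (A [ σ ]) ]) (q (A [ σ ])) (q (A [ σ ]))
        e₀ = trans ([∘] (IdFam A) (lift² σ refl) ⟪ q (A [ σ ]) ⟫)
               (trans (cong (_[ ⟪ q (A [ σ ]) ⟫ ]) (IdFam-[] σ refl)) (IdFam-diag (A [ σ ])))

      [rflₛ]-natural : ∀ {Γ Δ} {A : Ty Γ} (D : Ty (Γ ▹ A ▹ A [ p A ] ▹ IdFam A)) (σ : Δ ⇒ Γ) →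
                       D [ rflₛ A ] [ σ ⁺ ] ≡ D [ lift³ σ ] [ rflₛ (A [ σ ]) ]
      [rflₛ]-natural D σ = trans (sym ([∘] D _ _)) (trans (cong (D [_]) (rflₛ-natural σ)) ([∘] D _ _))

  record IdTypes : Set (o ⊔ h ⊔ t ⊔ m) where
    field
      intro : IdIntro
    open IdIntro intro public
    field
      J    : ∀ {Γ} (A : Ty Γ) (D : Ty (Γ ▹ A ▹ A [ p A ] ▹ IdFam A)) →
             Tm (Γ ▹ A) (D [ rflₛ A ]) → Tm (Γ ▹ A ▹ A [ p A ] ▹ IdFam A) D
      J-β  : ∀ {Γ} (A : Ty Γ) (D : Ty (Γ ▹ A ▹ A [ p A ] ▹ IdFam A))
             (d : Tm (Γ ▹ A) (D [ rflₛ A ])) → tmSub (rflₛ A) refl (J A D d) ≡ d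
      J-[] : ∀ {Γ Δ} (A : Ty Γ) (σ : Δ ⇒ Γ) (D : Ty (Γ ▹ A ▹ A [ p A ] ▹ IdFam A))
             (d : Tm (Γ ▹ A) (D [ rflₛ A ])) →
             tmSub (lift³ σ) refl (J A D d) ≡
             J (A [ σ ]) (D [ lift³ σ ]) (tmSub (σ ⁺) ([rflₛ]-natural D σ) d)

  record ContrFormers : Set (o ⊔ h ⊔ t ⊔ m) where
    field
      Πf  : ΠFormer
      Σf  : ΣFormer
      Idf : IdFormer
    open ΠFormer Πf public
    open ΣFormer Σf public
    open IdFormer Idf public

    isContr : ∀ {Γ} → Ty Γ → Ty Γ
    isContr A = Sg A (Π (A [ p A ]) (IdFam A))

    opaque
      isContr-[] : ∀ {Γ Δ} {A : Ty Γ} {A′} (σ : Δ ⇒ Γ) → A [ σ ] ≡ A′ →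
                   isContr A [ σ ] ≡ isContr A′
      isContr-[] σ e = Sg-[]′ σ e (Π-[]′ (lift⁺ σ e) ([p][lift] e) (IdFam-[] σ e))

  record TypeFormers : Set (o ⊔ h ⊔ t ⊔ m) where
    field
      Πs       : ΠTypes
      Σs       : ΣTypes
      unit     : UnitType
      empty    : EmptyType
      coprods  : Coproducts
      naturals : NatType
      Ids      : IdTypes

    contrFormers : ContrFormers
    contrFormers = record
      { Πf = ΠTypes.former Πs ; Σf = ΣTypes.former Σs ; Idf = IdTypes.former Ids }

record ExoNatProducts {o h t m : Level} (C : CwF o h t m) (I : IdFormer C) : Set (o ⊔ h ⊔ t ⊔ m) where
  open CwF C
  open IdFormer I
  field
    Ω    : ∀ {Γ} → (ℕ → Ty Γ) → Ty Γ
    Ω-[] : ∀ {Γ Δ} (σ : Δ ⇒ Γ) (Y : ℕ → Ty Γ) → Ω Y [ σ ] ≡ Ω (λ n → Y n [ σ ])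
    bij  : ∀ {Γ} (Y : ℕ → Ty Γ) → Tm Γ (Ω Y) ↔ (∀ n → Tm Γ (Y n))

  φ : ∀ {Γ} {Y : ℕ → Ty Γ} → Tm Γ (Ω Y) → ∀ n → Tm Γ (Y n)
  φ = Inverse.to (bij _)

  ψ : ∀ {Γ} {Y : ℕ → Ty Γ} → (∀ n → Tm Γ (Y n)) → Tm Γ (Ω Y)
  ψ = Inverse.from (bij _)

  field
    -- Naturality of the bijection, stated for ψ (equivalently, for φ).
    ψ-[]     : ∀ {Γ Δ} (σ : Δ ⇒ Γ) (Y : ℕ → Ty Γ) (d : ∀ n → Tm Γ (Y n)) →
               tmSub σ (Ω-[] σ Y) (ψ d) ≡ ψ (λ n → tmSub σ refl (d n))
    Ω-ext    : ∀ {Γ} {Y : ℕ → Ty Γ} (d c : ∀ n → Tm Γ (Y n)) →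
               (∀ n → Tm Γ (Id (Y n) (d n) (c n))) → Tm Γ (Id (Ω Y) (ψ d) (ψ c))
    Ω-ext-[] : ∀ {Γ Δ} {Y : ℕ → Ty Γ} (σ : Δ ⇒ Γ) (d c : ∀ n → Tm Γ (Y n))
               (h : ∀ n → Tm Γ (Id (Y n) (d n) (c n))) →
               tmSub σ (Id-[]′ σ (Ω-[] σ Y) (ψ-[] σ Y d) (ψ-[] σ Y c)) (Ω-ext d c h) ≡
               Ω-ext (λ n → tmSub σ refl (d n)) (λ n → tmSub σ refl (c n))
                     (λ n → tmSub σ (Id-[] σ) (h n))

record TwoLevelCwF (o h t m t′ : Level) : Set (lsuc (o ⊔ h ⊔ t ⊔ m ⊔ t′)) where
  no-eta-equality
  field
    exo  : CwF o h t m
  open CwF exo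
  field
    tyᶠ  : Presheaf cat t′
    conv : NatTrans tyᶠ tyPsh

  open NatTrans conv using () renaming (η to c; natural to c-natural) public

  private
    tmSub-subst : ∀ {Γ Δ A B B′} {θ : Δ ⇒ Γ} {a : Tm Γ A} (n : A ≡ B) (e : B [ θ ] ≡ B′)
                  (e′ : A [ θ ] ≡ B′) → tmSub θ e (subst (Tm Γ) n a) ≡ tmSub θ e′ a
    tmSub-subst refl e e′ = tmSub-cong refl refl

  -- The second CwF structure, with Tmᶠ(Γ , A) = Tmᵉ(Γ , c A) and Γ.A = Γ.(c A).
  fib : CwF o h t′ m
  fib .CwF.cat           = cat
  fib .CwF.𝟙             = 𝟙
  fib .CwF.!             = !
  fib .CwF.!-unique      = !-unique
  fib .CwF.tyPsh         = tyᶠ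
  fib .CwF.tmPsh         = reindex conv tmPsh
  fib .CwF._▹_ Γ A       = Γ ▹ c A
  fib .CwF.p A           = p (c A)
  fib .CwF.q A           = subst (Tm _) (c-natural (p (c A)) A) (q (c A))
  fib .CwF.comprehension A σ a =
    ext σ (c-natural σ A) a
    , (p-ext , trans (tmSub-subst (c-natural _ A) _ ([p][ext] (c-natural σ A))) (q-ext _))
    , λ { {θ} (refl , qθ) → ext-unique θ refl
          (trans (sym ([∘] (c A) (p (c A)) θ)) (c-natural _ A))
          (trans (sym (tmSub-subst (c-natural _ A) _ _)) qθ) }

-- Isomorphism of types over Γ, i.e. of their context extensions in the slice over Γ.
record TyIso {o h t m : Level} (C : CwF o h t m) {Γ : CwF.Ob C} (A B : CwF.Ty C Γ) : Set h where
  open CwF C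
  field
    to      : Γ ▹ A ⇒ Γ ▹ B
    from    : Γ ▹ B ⇒ Γ ▹ A
    p∘to    : p B ∘ to ≡ p A
    p∘from  : p A ∘ from ≡ p B
    to∘from : to ∘ from ≡ id
    from∘to : from ∘ to ≡ id

record CofibFormers {o h t m t′ : Level} (D : TwoLevelCwF o h t m t′) : Set (o ⊔ h ⊔ t ⊔ m ⊔ t′) where
  open TwoLevelCwF D
  field
    Πᵉ    : ΠFormer exo
    contr : ContrFormers fib

module _ {o h t m t′ : Level} (D : TwoLevelCwF o h t m t′) (F : CofibFormers D) where
  open TwoLevelCwF D
  open CwF exo
  private module f = CwF fib
  open CofibFormers F
  open ΠFormer Πᵉ
  open ContrFormers contr using (isContr; isContr-[])

  record Cofibrant {Γ : Ob} (A : Ty Γ) : Set (o ⊔ h ⊔ t ⊔ m ⊔ t′) where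

    -- τ⁺ : Υ.A[σ∘τ] → Δ.A[σ]
    [_]⁺ : ∀ {Δ Υ} {σ : Δ ⇒ Γ} (τ : Υ ⇒ Δ) → Υ ▹ A [ σ ∘ τ ] ⇒ Δ ▹ A [ σ ]
    [_]⁺ {σ = σ} τ = lift⁺ τ (sym ([∘] A σ τ))

    field
      Θᵀʸ         : ∀ {Δ} (σ : Δ ⇒ Γ) → f.Ty (Δ ▹ A [ σ ]) → f.Ty Δ
      Θᵀʸ-natural : ∀ {Δ Υ} (σ : Δ ⇒ Γ) (τ : Υ ⇒ Δ) (Y : f.Ty (Δ ▹ A [ σ ])) →
                    Θᵀʸ σ Y f.[ τ ] ≡ Θᵀʸ (σ ∘ τ) (Y f.[ [ τ ]⁺ ])

    c-Θ-[] : ∀ {Δ Υ} (σ : Δ ⇒ Γ) (τ : Υ ⇒ Δ) (Y : f.Ty (Δ ▹ A [ σ ])) →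
             c (Θᵀʸ σ Y) [ τ ] ≡ c (Θᵀʸ (σ ∘ τ) (Y f.[ [ τ ]⁺ ]))
    c-Θ-[] σ τ Y = trans (c-natural τ _) (cong c (Θᵀʸ-natural σ τ Y))

    Π-c-[] : ∀ {Δ Υ} (σ : Δ ⇒ Γ) (τ : Υ ⇒ Δ) (Y : f.Ty (Δ ▹ A [ σ ])) →
             Π (A [ σ ]) (c Y) [ τ ] ≡ Π (A [ σ ∘ τ ]) (c (Y f.[ [ τ ]⁺ ]))
    Π-c-[] σ τ Y = Π-[]′ τ (sym ([∘] A σ τ)) (c-natural [ τ ]⁺ Y)

    field
      iso         : ∀ {Δ} (σ : Δ ⇒ Γ) (Y : f.Ty (Δ ▹ A [ σ ])) →
                    TyIso exo (c (Θᵀʸ σ Y)) (Π (A [ σ ]) (c Y))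
      iso-natural : ∀ {Δ Υ} (σ : Δ ⇒ Γ) (τ : Υ ⇒ Δ) (Y : f.Ty (Δ ▹ A [ σ ])) →
                    TyIso.to (iso σ Y) ∘ lift⁺ τ (c-Θ-[] σ τ Y) ≡
                    lift⁺ τ (Π-c-[] σ τ Y) ∘ TyIso.to (iso (σ ∘ τ) (Y f.[ [ τ ]⁺ ]))
      Θᵀᵐ         : ∀ {Δ} (σ : Δ ⇒ Γ) (Y : f.Ty (Δ ▹ A [ σ ])) →
                    f.Tm (Δ ▹ A [ σ ]) (isContr Y) → f.Tm Δ (isContr (Θᵀʸ σ Y))
      Θᵀᵐ-natural : ∀ {Δ Υ} (σ : Δ ⇒ Γ) (τ : Υ ⇒ Δ) (Y : f.Ty (Δ ▹ A [ σ ]))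
                    (h : f.Tm (Δ ▹ A [ σ ]) (isContr Y)) →
                    f.tmSub τ (isContr-[] τ (Θᵀʸ-natural σ τ Y)) (Θᵀᵐ σ Y h) ≡
                    Θᵀᵐ (σ ∘ τ) (Y f.[ [ τ ]⁺ ]) (f.tmSub [ τ ]⁺ (isContr-[] [ τ ]⁺ refl) h)

FunExt : Setω
FunExt = ∀ {a b} → Extensionality a b

coe : ∀ {a} {A B : Set a} → A ≡ B → A → B
coe = subst (λ X → X)

coe-uip : ∀ {a} {A : Set a} (e : A ≡ A) (x : A) → coe e x ≡ x
coe-uip refl x = refl

-- For a presheaf A on ∫P this is T̂m(P , A): compat ranges over the morphisms
-- σ : (Δ , x[σ]) → (Γ , x) of ∫P.
record Section {o h s : Level} {C : Category o h} (A : Presheaf C s) : Set (o ⊔ h ⊔ s) where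
  constructor mkSection
  open Category C
  open Presheaf A
  field
    el     : ∀ X → F₀ X
    compat : ∀ {X Y} (f : Y ⇒ X) → F₁ f (el X) ≡ el Y

reindexSection : ∀ {o h s s′ r} {C : Category o h} {P : Presheaf C s} {Q : Presheaf C s′}
                 (φ : NatTrans P Q) {A : Presheaf (∫ Q) r} → Section A → Section (reindex φ A)
reindexSection φ a .Section.el (Γ , x) = Section.el a (Γ , NatTrans.η φ x)
reindexSection φ a .Section.compat f   = Section.compat a _

-- E is independent of e, so that it can be refl as soon as the two fibres agree.
el-subst : ∀ {o h s} {C : Category o h} {A B : Presheaf C s} (e : A ≡ B) (a : Section A) X
           (E : Presheaf.F₀ A X ≡ Presheaf.F₀ B X) →
           Section.el (subst Section e a) X ≡ coe E (Section.el a X)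
el-subst refl a X E = sym (coe-uip E _)

idₙ : ∀ {o h s} {C : Category o h} {P : Presheaf C s} → NatTrans P P
idₙ .NatTrans.η x         = x
idₙ .NatTrans.natural σ x = refl

module _ {o h s s′ s″ : Level} {C : Category o h}
         {P : Presheaf C s} {Q : Presheaf C s′} {R : Presheaf C s″} where
  private
    module P = Presheaf P
    module R = Presheaf R
    opaque
      ∘ₙ-natural : ∀ (φ : NatTrans Q R) (ψ : NatTrans P Q) {Γ Δ} (σ : Category._⇒_ C Δ Γ) (x : P.F₀ Γ) →
        R.F₁ σ (NatTrans.η φ (NatTrans.η ψ x)) ≡ NatTrans.η φ (NatTrans.η ψ (P.F₁ σ x))
      ∘ₙ-natural φ ψ σ x = trans (NatTrans.natural φ σ _) (cong (NatTrans.η φ) (NatTrans.natural ψ σ x))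

  _∘ₙ_ : NatTrans Q R → NatTrans P Q → NatTrans P R
  (φ ∘ₙ ψ) .NatTrans.η x     = NatTrans.η φ (NatTrans.η ψ x)
  (φ ∘ₙ ψ) .NatTrans.natural = ∘ₙ-natural φ ψ

module Equalities (funext : FunExt) where

  private
    funextᵢ : ∀ {a b} → {A : Set a} {B : A → Set b} {f g : {x : A} → B x} →
              (∀ {x} → f {x} ≡ g {x}) → (λ {x} → f {x}) ≡ (λ {x} → g {x})
    funextᵢ = implicit-extensionality funext

  module _ {o h s : Level} {C : Category o h} where
    open Category C
    private
      psh-≡′ : {F₀ G₀ : Ob → Set s}
        {F₁ : ∀ {Γ Δ} → Δ ⇒ Γ → F₀ Γ → F₀ Δ}
        {G₁ : ∀ {Γ Δ} → Δ ⇒ Γ → G₀ Γ → G₀ Δ}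
        {i  : ∀ {Γ} (x : F₀ Γ) → F₁ id x ≡ x}
        {i′ : ∀ {Γ} (x : G₀ Γ) → G₁ id x ≡ x}
        {c  : ∀ {Γ Δ Θ} (σ : Δ ⇒ Γ) (τ : Θ ⇒ Δ) (x : F₀ Γ) → F₁ (σ ∘ τ) x ≡ F₁ τ (F₁ σ x)}
        {c′ : ∀ {Γ Δ Θ} (σ : Δ ⇒ Γ) (τ : Θ ⇒ Δ) (x : G₀ Γ) → G₁ (σ ∘ τ) x ≡ G₁ τ (G₁ σ x)}
        (e : F₀ ≡ G₀) →
        _≡_ {A = ∀ {Γ Δ} → Δ ⇒ Γ → G₀ Γ → G₀ Δ}
            (subst (λ H → ∀ {Γ Δ} → Δ ⇒ Γ → H Γ → H Δ) e F₁) G₁ →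
        mkPsh {C = C} F₀ F₁ i c ≡ mkPsh G₀ G₁ i′ c′
      psh-≡′ {F₀} {F₁ = F₁} {i = i} {i′} {c} {c′} refl refl = go i i′ c c′
        (funextᵢ λ {Γ} → funext λ x → uip _ _)
        (funextᵢ λ {Γ} → funextᵢ λ {Δ} → funextᵢ λ {Θ} →
           funext λ σ → funext λ τ → funext λ x → uip _ _)
        where
        I = ∀ {Γ} (x : F₀ Γ) → F₁ id x ≡ x
        K = ∀ {Γ Δ Θ} (σ : Δ ⇒ Γ) (τ : Θ ⇒ Δ) (x : F₀ Γ) → F₁ (σ ∘ τ) x ≡ F₁ τ (F₁ σ x)
        go : (i i′ : I) (c c′ : K) → _≡_ {A = I} i i′ → _≡_ {A = K} c c′ →
             mkPsh {C = C} F₀ F₁ i c ≡ mkPsh F₀ F₁ i′ c′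
        go i i′ c c′ refl refl = refl

    opaque
      psh-≡ : {A B : Presheaf C s} (e : ∀ X → Presheaf.F₀ A X ≡ Presheaf.F₀ B X) →
              (∀ {X Y} (f : Y ⇒ X) a →
                 coe (e Y) (Presheaf.F₁ A f a) ≡ Presheaf.F₁ B f (coe (e X) a)) →
              A ≡ B
      psh-≡ {A@(mkPsh _ _ _ _)} {B@(mkPsh _ _ _ _)} e e₁ = psh-≡′ (funext e)
        (funextᵢ λ {Γ} → funextᵢ λ {Δ} → funext λ f → funext λ b → 
          lemma {F₁ = Presheaf.F₁ A} {Presheaf.F₁ B} (funext e) e f b (e₁ f))
        where
        lemma : ∀ {F₀ G₀ : Ob → Set s} {F₁ : ∀ {Γ Δ} → Δ ⇒ Γ → F₀ Γ → F₀ Δ}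
                {G₁ : ∀ {Γ Δ} → Δ ⇒ Γ → G₀ Γ → G₀ Δ} (E : F₀ ≡ G₀)
                (e : ∀ X → F₀ X ≡ G₀ X) {X Y} (f : Y ⇒ X) (b : G₀ X) →
                (∀ a → coe (e Y) (F₁ f a) ≡ G₁ f (coe (e X) a)) →
                subst (λ H → ∀ {Γ Δ} → Δ ⇒ Γ → H Γ → H Δ) E F₁ f b ≡ G₁ f b
        lemma {G₁ = G₁} refl e f b e₁ =
          trans (sym (coe-uip (e _) _)) (trans (e₁ b) (cong (G₁ f) (coe-uip (e _) b)))

  module _ {o h s s′ : Level} {C : Category o h} {P : Presheaf C s} {Q : Presheaf C s′} where
    open Category C
    private
      module P = Presheaf P
      module Q = Presheaf Q

      Natural : (∀ {Γ} → P.F₀ Γ → Q.F₀ Γ) → Set (o ⊔ h ⊔ s ⊔ s′)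
      Natural η = ∀ {Γ Δ} (σ : Δ ⇒ Γ) (x : P.F₀ Γ) → Q.F₁ σ (η x) ≡ η (P.F₁ σ x)

      nat-≡′ : {η η′ : ∀ {Γ} → P.F₀ Γ → Q.F₀ Γ} (n : Natural η) (n′ : Natural η′) →
               _≡_ {A = ∀ {Γ} → P.F₀ Γ → Q.F₀ Γ} η η′ → mkNat {P = P} {Q} η n ≡ mkNat η′ n′
      nat-≡′ {η} n n′ refl = go n n′
        (funextᵢ λ {Γ} → funextᵢ λ {Δ} → funext λ σ → funext λ x → uip _ _)
        where
        go : (n n′ : Natural η) → _≡_ {A = Natural η} n n′ → mkNat {P = P} {Q} η n ≡ mkNat η n′
        go n n′ refl = refl

    opaque
      nat-≡ : {φ ψ : NatTrans P Q} →
              (∀ {Γ} (x : P.F₀ Γ) → NatTrans.η φ x ≡ NatTrans.η ψ x) → φ ≡ ψ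
      nat-≡ {mkNat _ n} {mkNat _ n′} e = nat-≡′ n n′ (funextᵢ λ {Γ} → funext e)

  module _ {o h s : Level} {C : Category o h} {A : Presheaf C s} where
    open Category C
    open Presheaf A
    private
      Compatible : (∀ X → F₀ X) → Set (o ⊔ h ⊔ s)
      Compatible f = ∀ {X Y} (h : Y ⇒ X) → F₁ h (f X) ≡ f Y

      section-≡′ : {f g : ∀ X → F₀ X} (c : Compatible f) (d : Compatible g) → f ≡ g →
                   mkSection {A = A} f c ≡ mkSection g d
      section-≡′ {f} c d refl = go c d (funextᵢ λ {X} → funextᵢ λ {Y} → funext λ h → uip _ _)
        where
        go : (c d : Compatible f) → _≡_ {A = Compatible f} c d →
             mkSection {A = A} f c ≡ mkSection f d
        go c d refl = refl

    opaque
      section-≡ : {a b : Section A} → (∀ X → Section.el a X ≡ Section.el b X) → a ≡ b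
      section-≡ {mkSection _ c} {mkSection _ d} e = section-≡′ c d (funext e)

  opaque
    reindex-id : ∀ {o h s r} {C : Category o h} (P : Presheaf C s)
                 (A : Presheaf (∫ P) r) → reindex (idₙ {P = P}) A ≡ A
    reindex-id P A = psh-≡ (λ X → refl) (λ f a → cong (λ k → Presheaf.F₁ A k a) (∫-≡ P refl))

    reindex-∘ : ∀ {o h s s′ s″ r} {C : Category o h}
                {P : Presheaf C s} {Q : Presheaf C s′} {R : Presheaf C s″}
                (φ : NatTrans Q R) (ψ : NatTrans P Q) (A : Presheaf (∫ R) r) →
                reindex (φ ∘ₙ ψ) A ≡ reindex ψ (reindex φ A)
    reindex-∘ {R = R} φ ψ A =
      psh-≡ (λ X → refl) (λ f a → cong (λ k → Presheaf.F₁ A k a) (∫-≡ R refl))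

-- The total presheaf P.A of a presheaf A on ∫P.
module _ {o h s r : Level} {C : Category o h} (P : Presheaf C s) (A : Presheaf (∫ P) r) where
  open Category C
  private
    module P = Presheaf P
    module A = Presheaf A
    ▹F₁ : ∀ {Γ Δ} → Δ ⇒ Γ → Σ[ x ∈ P.F₀ Γ ] A.F₀ (Γ , x) → Σ[ x ∈ P.F₀ Δ ] A.F₀ (Δ , x)
    ▹F₁ σ (x , a) = P.F₁ σ x , A.F₁ (σ , refl) a

  ▹-act : ∀ {Γ Δ} (σ : Δ ⇒ Γ) {x y} {a : A.F₀ (Γ , x)} {b : A.F₀ (Δ , y)}
          (e : P.F₁ σ x ≡ y) → A.F₁ (σ , e) a ≡ b → ▹F₁ σ (x , a) ≡ (y , b)
  ▹-act σ refl refl = refl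

  private
    opaque
      ▹F-id : ∀ {Γ} (z : Σ[ x ∈ P.F₀ Γ ] A.F₀ (Γ , x)) → ▹F₁ id z ≡ z
      ▹F-id (x , a) = ▹-act id (P.F-id x) (A.F-id a)

      ▹F-∘ : ∀ {Γ Δ Θ} (σ : Δ ⇒ Γ) (τ : Θ ⇒ Δ) (z : Σ[ x ∈ P.F₀ Γ ] A.F₀ (Γ , x)) →
             ▹F₁ (σ ∘ τ) z ≡ ▹F₁ τ (▹F₁ σ z)
      ▹F-∘ σ τ (x , a) = ▹-act (σ ∘ τ) (P.F-∘ σ τ x)
        (trans (cong (λ k → A.F₁ k a) (∫-≡ P refl)) (A.F-∘ (σ , refl) (τ , refl) a))

  total : Presheaf C (s ⊔ r)
  total .Presheaf.F₀ Γ = Σ[ x ∈ P.F₀ Γ ] A.F₀ (Γ , x)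
  total .Presheaf.F₁   = ▹F₁
  total .Presheaf.F-id = ▹F-id
  total .Presheaf.F-∘  = ▹F-∘

  proj : NatTrans total P
  proj .NatTrans.η             = proj₁
  proj .NatTrans.natural σ x   = refl

  var : Section (reindex proj A)
  var .Section.el (Γ , (x , a))  = a
  var .Section.compat {_ , (_ , a)} (σ , refl) = cong (λ k → A.F₁ k a) (∫-≡ P refl)

  tuple : ∀ {s′} {Q : Presheaf C s′} (φ : NatTrans Q P) → Section (reindex φ A) → NatTrans Q total
  tuple φ a .NatTrans.η y         = NatTrans.η φ y , Section.el a (_ , y)
  tuple φ a .NatTrans.natural σ y = ▹-act σ (NatTrans.natural φ σ y)
    (trans (cong (λ k → A.F₁ k (Section.el a (_ , y))) (∫-≡ P refl))
           (Section.compat a (σ , refl)))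

module _ (funext : FunExt) {ℓ : Level} (C : Category ℓ ℓ) where
  open Equalities funext

  presheafCat : Category (lsuc ℓ) ℓ
  presheafCat .Category.Ob          = Presheaf C ℓ
  presheafCat .Category._⇒_         = NatTrans
  presheafCat .Category.id          = idₙ
  presheafCat .Category._∘_         = _∘ₙ_
  presheafCat .Category.idˡ φ       = nat-≡ λ x → refl
  presheafCat .Category.idʳ φ       = nat-≡ λ x → refl
  presheafCat .Category.assoc φ ψ χ = nat-≡ λ x → refl

  presheafTy : Presheaf presheafCat (lsuc ℓ)
  presheafTy .Presheaf.F₀ P       = Presheaf (∫ P) ℓ
  presheafTy .Presheaf.F₁         = reindex
  presheafTy .Presheaf.F-id {P} A = reindex-id P A
  presheafTy .Presheaf.F-∘        = reindex-∘

  presheafTm : Presheaf (∫ presheafTy) ℓ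
  presheafTm .Presheaf.F₀ (P , A)         = Section A
  presheafTm .Presheaf.F₁ (φ , e) a       = subst Section e (reindexSection φ a)
  presheafTm .Presheaf.F-id {P , A} a     = section-≡ λ X →
    el-subst (reindex-id P A) (reindexSection (idₙ {P = P}) a) X refl
  presheafTm .Presheaf.F-∘ {P , A} (φ , refl) (ψ , refl) a = section-≡ λ X →
    el-subst (trans (reindex-∘ φ ψ A) refl) (reindexSection (φ ∘ₙ ψ) a) X refl

  private
    𝟙ₚ : Presheaf C ℓ
    𝟙ₚ .Presheaf.F₀ Γ     = ⊤
    𝟙ₚ .Presheaf.F₁ σ x   = tt
    𝟙ₚ .Presheaf.F-id x   = refl
    𝟙ₚ .Presheaf.F-∘ σ τ x = refl

    var-value : ∀ {P Q : Presheaf C ℓ} (A : Presheaf (∫ P) ℓ) (θ : NatTrans Q (total P A)) {φ}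
                (e : proj P A ∘ₙ θ ≡ φ) ((Γ , y) : Σ (Category.Ob C) (Presheaf.F₀ Q))
                (E : Presheaf.F₀ A (Γ , proj₁ (NatTrans.η θ y)) ≡ Presheaf.F₀ A (Γ , NatTrans.η φ y)) →
                Section.el (subst Section (trans (sym (reindex-∘ (proj P A) θ A))
                                                 (cong (λ φ → reindex φ A) e))
                                          (reindexSection θ (var P A))) (Γ , y) ≡
                coe E (proj₂ (NatTrans.η θ y))
    var-value {P} A θ {φ} e X E =
      el-subst (trans (sym (reindex-∘ (proj P A) θ A)) (cong (λ φ → reindex φ A) e))
               (reindexSection θ (var P A)) X E

  presheafCwF : CwF (lsuc ℓ) ℓ (lsuc ℓ) ℓ
  presheafCwF .CwF.cat             = presheafCat
  presheafCwF .CwF.𝟙               = 𝟙ₚ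
  presheafCwF .CwF.! P             = mkNat (λ x → tt) (λ σ x → refl)
  presheafCwF .CwF.!-unique φ      = nat-≡ λ x → refl
  presheafCwF .CwF.tyPsh           = presheafTy
  presheafCwF .CwF.tmPsh           = presheafTm
  presheafCwF .CwF._▹_             = total
  presheafCwF .CwF.p {P} A         = proj P A
  presheafCwF .CwF.q {P} A         = var P A
  presheafCwF .CwF.comprehension {P} {Q} A φ a =
    tuple P A φ a
    , (nat-≡ (λ x → refl) , section-≡ λ X → var-value A (tuple P A φ a) (nat-≡ λ x → refl) X refl)
    , λ { {θ} (refl , refl) → nat-≡ λ y →
          cong (proj₁ (NatTrans.η θ y) ,_) (var-value A θ refl (_ , y) refl) }

module ExoΠTypes (funext : FunExt) {ℓ : Level} (C : Category ℓ ℓ) where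
  open Equalities funext
  open Category C

  private
    funextᵢ : ∀ {a b} → {A : Set a} {B : A → Set b} {f g : {x : A} → B x} →
              (∀ {x} → f {x} ≡ g {x}) → (λ {x} → f {x}) ≡ (λ {x} → g {x})
    funextᵢ = implicit-extensionality funext

  module ExoΠ {P : Presheaf C ℓ} (A : Presheaf (∫ P) ℓ) (B : Presheaf (∫ (total P A)) ℓ) where
    private
      module P = Presheaf P
      module A = Presheaf A
      module B = Presheaf B

    module _ {Γ} (y : ∀ Δ → Δ ⇒ Γ → P.F₀ Δ) where
      Y-[] : Set ℓ
      Y-[] = ∀ {Δ Θ} (σ : Δ ⇒ Γ) (τ : Θ ⇒ Δ) → P.F₁ τ (y Δ σ) ≡ y Θ (σ ∘ τ)

      YA-[] : Y-[] → Set ℓ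
      YA-[] r = ∀ {Δ Θ} (σ : Δ ⇒ Γ) (τ : Θ ⇒ Δ) (a : A.F₀ (Δ , y Δ σ)) →
        Presheaf.F₁ (total P A) τ (y Δ σ , a) ≡ (y Θ (σ ∘ τ) , A.F₁ (τ , r σ τ) a)

    -- Families f(Δ,σ,a) ∈ B(Δ,(y σ,a)) with f(Δ,σ,a)[τ] = f(Θ,σ∘τ,a[τ]).
    -- In Πᵉ(A , B)(Γ , x) = ΠFam x, y σ is x[σ]; it is a parameter because
    -- φ(x)[σ] and φ(x[σ]) must be exchanged to substitute φ in Πᵉ(A , B).
    -- r and s are the identifications y(σ)[τ] = y(σ∘τ) and
    -- (y σ , a)[τ] = (y(σ∘τ) , a[τ]) needed to state the equation.
    Fam : ∀ {Γ} (y : ∀ Δ → Δ ⇒ Γ → P.F₀ Δ) (r : Y-[] y) → YA-[] y r → Set ℓ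
    Fam {Γ} y r s =
      Σ[ f ∈ (∀ {Δ} (σ : Δ ⇒ Γ) (a : A.F₀ (Δ , y Δ σ)) → B.F₀ (Δ , (y Δ σ , a))) ]
        (∀ {Δ Θ} (σ : Δ ⇒ Γ) (τ : Θ ⇒ Δ) (a : A.F₀ (Δ , y Δ σ)) →
           B.F₁ (τ , s σ τ a) (f σ a) ≡ f (σ ∘ τ) (A.F₁ (τ , r σ τ) a))

    ΠFam : ∀ {Γ} → P.F₀ Γ → Set ℓ
    ΠFam x = Fam (λ Δ σ → P.F₁ σ x) (λ σ τ → sym (P.F-∘ σ τ x))
                 (λ σ τ a → ▹-act P A τ (sym (P.F-∘ σ τ x)) refl)

    module Fams {Γ} (y : ∀ Δ → Δ ⇒ Γ → P.F₀ Δ) (r : Y-[] y) (s : YA-[] y r) where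

      -- f(Δ,σ,a), for a over any z equal to y σ.
      at : Fam y r s → ∀ {Δ} (σ : Δ ⇒ Γ) {z} → y Δ σ ≡ z →
           (a : A.F₀ (Δ , z)) → B.F₀ (Δ , (z , a))
      at f σ refl a = proj₁ f σ a

      at-cong : ∀ (f : Fam y r s) {Δ} {σ σ′ : Δ ⇒ Γ} {z}
                (e : y Δ σ ≡ z) (e′ : y Δ σ′ ≡ z) (a : A.F₀ (Δ , z)) →
                σ ≡ σ′ → at f σ e a ≡ at f σ′ e′ a
      at-cong f {σ = σ} e e′ a refl = cong (λ e → at f σ e a) (uip e e′)

      at-nat : ∀ (f : Fam y r s) {Δ Θ} (σ : Δ ⇒ Γ) (τ : Θ ⇒ Δ) {z w}
               (e : y Δ σ ≡ z) (e₁ : P.F₁ τ z ≡ w) (e′ : y Θ (σ ∘ τ) ≡ w) (a : A.F₀ (Δ , z))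
               (E : Presheaf.F₁ (total P A) τ (z , a) ≡ (w , A.F₁ (τ , e₁) a)) →
               B.F₁ (τ , E) (at f σ e a) ≡ at f (σ ∘ τ) e′ (A.F₁ (τ , e₁) a)
      at-nat f σ τ refl e₁ refl a E = go e₁ E (uip e₁ (r σ τ))
        where
        go : ∀ e₁ (E : Presheaf.F₁ (total P A) τ (_ , a) ≡ (_ , A.F₁ (τ , e₁) a)) → e₁ ≡ r σ τ →
             B.F₁ (τ , E) (proj₁ f σ a) ≡ proj₁ f (σ ∘ τ) (A.F₁ (τ , e₁) a)
        go _ E refl = trans (cong (λ k → B.F₁ k _) (∫-≡ (total P A) refl)) (proj₂ f σ τ a)

      private
        F = ∀ {Δ} (σ : Δ ⇒ Γ) (a : A.F₀ (Δ , y Δ σ)) → B.F₀ (Δ , (y Δ σ , a))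
        N : F → Set ℓ
        N f = ∀ {Δ Θ} (σ : Δ ⇒ Γ) (τ : Θ ⇒ Δ) (a : A.F₀ (Δ , y Δ σ)) →
              B.F₁ (τ , s σ τ a) (f σ a) ≡ f (σ ∘ τ) (A.F₁ (τ , r σ τ) a)
        fam-≡₁ : ∀ {f : F} (n n′ : N f) → _≡_ {A = N f} n n′ → _≡_ {A = Fam y r s} (f , n) (f , n′)
        fam-≡₁ n n′ refl = refl
        fam-≡₂ : ∀ {f g : F} (n : N f) (n′ : N g) → _≡_ {A = F} f g →
                 _≡_ {A = Fam y r s} (f , n) (g , n′)
        fam-≡₂ n n′ refl = fam-≡₁ n n′
          (funextᵢ (funextᵢ (funext λ σ → funext λ τ → funext λ a → uip _ _)))

      opaque
        fam-≡ : {f g : Fam y r s} → (∀ {Δ} (σ : Δ ⇒ Γ) a → proj₁ f σ a ≡ proj₁ g σ a) → f ≡ g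
        fam-≡ {f} {g} e = fam-≡₂ (proj₂ f) (proj₂ g) (funextᵢ (funext λ σ → funext λ a → e σ a))

    module At {Γ} (x : P.F₀ Γ) =
      Fams (λ Δ σ → P.F₁ σ x) (λ σ τ → sym (P.F-∘ σ τ x))
           (λ σ τ a → ▹-act P A τ (sym (P.F-∘ σ τ x)) refl)

    act-eq : ∀ {Γ Γ′ Δ} (ρ : Γ′ ⇒ Γ) {x : P.F₀ Γ} {x′} → P.F₁ ρ x ≡ x′ → (σ : Δ ⇒ Γ′) →
             P.F₁ (ρ ∘ σ) x ≡ P.F₁ σ x′
    act-eq ρ {x} e σ = trans (P.F-∘ ρ σ x) (cong (P.F₁ σ) e)

    -- f[ρ](Δ,σ,a) = f(Δ,ρ∘σ,a).
    act : ∀ {Γ Γ′} (ρ : Γ′ ⇒ Γ) {x : P.F₀ Γ} {x′} → P.F₁ ρ x ≡ x′ → ΠFam x → ΠFam x′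
    act {Γ} {Γ′} ρ {x} {x′} e f =
      (λ σ a → At.at x f (ρ ∘ σ) (act-eq ρ e σ) a) , nat
      where
      nat : ∀ {Δ Θ} (σ : Δ ⇒ Γ′) (τ : Θ ⇒ Δ) (a : A.F₀ (Δ , P.F₁ σ x′)) →
            B.F₁ (τ , ▹-act P A τ (sym (P.F-∘ σ τ x′)) refl) (At.at x f (ρ ∘ σ) (act-eq ρ e σ) a) ≡
            At.at x f (ρ ∘ (σ ∘ τ)) (act-eq ρ e (σ ∘ τ)) (A.F₁ (τ , sym (P.F-∘ σ τ x′)) a)
      nat σ τ a = trans
        (At.at-nat x f (ρ ∘ σ) τ (act-eq ρ e σ) (sym (P.F-∘ σ τ x′)) e′ a _)
        (At.at-cong x f e′ (act-eq ρ e (σ ∘ τ)) (A.F₁ (τ , sym (P.F-∘ σ τ x′)) a) (assoc ρ σ τ))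
        where
        e′ : P.F₁ ((ρ ∘ σ) ∘ τ) x ≡ P.F₁ (σ ∘ τ) x′
        e′ = trans (cong (λ σ → P.F₁ σ x) (assoc ρ σ τ)) (act-eq ρ e (σ ∘ τ))

    opaque
      at-act : ∀ {Γ Γ′} (ρ : Γ′ ⇒ Γ) {x : P.F₀ Γ} {x′} (e : P.F₁ ρ x ≡ x′) (f : ΠFam x)
               {Δ} (σ : Δ ⇒ Γ′) {z} (e₁ : P.F₁ σ x′ ≡ z) (e₂ : P.F₁ (ρ ∘ σ) x ≡ z) a →
               At.at x′ (act ρ e f) σ e₁ a ≡ At.at x f (ρ ∘ σ) e₂ a
      at-act ρ {x} e f σ refl e₂ a = At.at-cong x f (act-eq ρ e σ) e₂ a refl

      act-id : ∀ {Γ} {x : P.F₀ Γ} (f : ΠFam x) → act id (P.F-id x) f ≡ f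
      act-id {x = x} f = At.fam-≡ x λ σ a →
        At.at-cong x f (act-eq id (P.F-id x) σ) refl a (idˡ σ)

      act-∘ : ∀ {Γ Δ Θ} (ρ : Δ ⇒ Γ) (ρ′ : Θ ⇒ Δ) {x y z} (e : P.F₁ ρ x ≡ y) (e′ : P.F₁ ρ′ y ≡ z)
              (e″ : P.F₁ (ρ ∘ ρ′) x ≡ z) (f : ΠFam x) →
              act (ρ ∘ ρ′) e″ f ≡ act ρ′ e′ (act ρ e f)
      act-∘ ρ ρ′ {x} {y} {z} e e′ e″ f = At.fam-≡ z λ σ a →
        let e₂ = trans (act-eq ρ e (ρ′ ∘ σ)) (act-eq ρ′ e′ σ) in
        trans (At.at-cong x f (act-eq (ρ ∘ ρ′) e″ σ) e₂ a (assoc ρ ρ′ σ))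
              (sym (at-act ρ e f (ρ′ ∘ σ) (act-eq ρ′ e′ σ) e₂ a))

    exoΠ : Presheaf (∫ P) ℓ
    exoΠ .Presheaf.F₀ (Γ , x) = ΠFam x
    exoΠ .Presheaf.F₁ (ρ , e) f = act ρ e f
    exoΠ .Presheaf.F-id = act-id
    exoΠ .Presheaf.F-∘ (ρ , e) (ρ′ , e′) f = act-∘ ρ ρ′ e e′ _ f

    private
      FamConv : ∀ {Γ} (y y′ : ∀ Δ → Δ ⇒ Γ → P.F₀ Δ) (r : Y-[] y) (r′ : Y-[] y′) →
                YA-[] y r → YA-[] y′ r′ → Set (lsuc ℓ)
      FamConv {Γ} y y′ r r′ s s′ =
        Σ[ E ∈ Fam y r s ≡ Fam y′ r′ s′ ]
          (∀ f {Δ} (σ : Δ ⇒ Γ) {z} (e : y Δ σ ≡ z) (e′ : y′ Δ σ ≡ z) (a : A.F₀ (Δ , z)) →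
             Fams.at y′ r′ s′ (coe E f) σ e′ a ≡ Fams.at y r s f σ e a)

      fam-conv₁ : ∀ {Γ} (y : ∀ Δ → Δ ⇒ Γ → P.F₀ Δ) (r : Y-[] y) (s s′ : YA-[] y r) →
                  _≡_ {A = YA-[] y r} s s′ → FamConv y y r r s s′
      fam-conv₁ y r s s′ refl = refl , λ f σ e e′ a → Fams.at-cong y r s f e′ e a refl

      fam-conv₂ : ∀ {Γ} (y : ∀ Δ → Δ ⇒ Γ → P.F₀ Δ) (r r′ : Y-[] y) (s : YA-[] y r) (s′ : YA-[] y r′) →
                  _≡_ {A = Y-[] y} r r′ → FamConv y y r r′ s s′
      fam-conv₂ y r r′ s s′ refl = fam-conv₁ y r s s′
        (funextᵢ (funextᵢ (funext λ σ → funext λ τ → funext λ a → uip _ _)))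

    opaque
      fam-conv : ∀ {Γ} (y y′ : ∀ Δ → Δ ⇒ Γ → P.F₀ Δ) (r : Y-[] y) (r′ : Y-[] y′)
                 (s : YA-[] y r) (s′ : YA-[] y′ r′) → y ≡ y′ →
        Σ[ E ∈ Fam y r s ≡ Fam y′ r′ s′ ]
          (∀ f {Δ} (σ : Δ ⇒ Γ) {z} (e : y Δ σ ≡ z) (e′ : y′ Δ σ ≡ z) (a : A.F₀ (Δ , z)) →
             Fams.at y′ r′ s′ (coe E f) σ e′ a ≡ Fams.at y r s f σ e a)
      fam-conv y _ r r′ s s′ refl = fam-conv₂ y r r′ s s′
        (funextᵢ (funextᵢ (funext λ σ → funext λ τ → uip _ _)))

  -- φ⁺ : Q.A[φ] → P.A, (x , a) ↦ (φ(x) , a).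
  liftₚ : ∀ {P Q : Presheaf C ℓ} (φ : NatTrans Q P) (A : Presheaf (∫ P) ℓ) →
          NatTrans (total Q (reindex φ A)) (total P A)
  liftₚ φ A .NatTrans.η (x , a) = NatTrans.η φ x , a
  liftₚ {P} φ A .NatTrans.natural σ (x , a) = ▹-act P A σ (NatTrans.natural φ σ x)
    (cong (λ f → Presheaf.F₁ A f a) (∫-≡ P refl))

  module _ {P Q : Presheaf C ℓ} (φ : NatTrans Q P)
           (A : Presheaf (∫ P) ℓ) (B : Presheaf (∫ (total P A)) ℓ) where
    private
      module P = Presheaf P
      module Q = Presheaf Q
      module φ = NatTrans φ
      module A = Presheaf A
      module B = Presheaf B
      module E = ExoΠ {P} A B
      module E′ = ExoΠ {Q} (reindex φ A) (reindex (liftₚ φ A) B)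

      -- E′.ΠFam x, as an instance of E.Fam.
      module _ {Γ} (x : Q.F₀ Γ) where
        y : ∀ Δ → Δ ⇒ Γ → P.F₀ Δ
        y Δ σ = φ.η (Q.F₁ σ x)
        r : E.Y-[] y
        r σ τ = natural′ φ τ (sym (Q.F-∘ σ τ x))
        s : E.YA-[] y r
        s σ τ a = natural′ (liftₚ φ A) τ (▹-act Q (reindex φ A) τ (sym (Q.F-∘ σ τ x)) refl)

        conv : Σ[ E ∈ E.ΠFam (φ.η x) ≡ E.Fam y r s ]
          (∀ f {Δ} (σ : Δ ⇒ Γ) {z} (e : P.F₁ σ (φ.η x) ≡ z) (e′ : y Δ σ ≡ z) (a : A.F₀ (Δ , z)) →
             E.Fams.at y r s (coe E f) σ e′ a ≡ E.At.at (φ.η x) f σ e a)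
        conv = E.fam-conv (λ Δ σ → P.F₁ σ (φ.η x)) y _ r _ s (funext λ Δ → funext λ σ → φ.natural σ x)

        at-at′ : (f : E.Fam y r s) → ∀ {Δ} (σ : Δ ⇒ Γ) {z : Q.F₀ Δ} (e : Q.F₁ σ x ≡ z)
                 (e′ : y Δ σ ≡ φ.η z) (a : A.F₀ (Δ , φ.η z)) →
                 E′.At.at x f σ e a ≡ E.Fams.at y r s f σ e′ a
        at-at′ f σ refl e′ a = E.Fams.at-cong y r s f refl e′ a refl

    -- The identification of Πᵉ(A , B)(Γ , φ(x)) with Πᵉ(A[φ] , B[φ⁺])(Γ , x).
    exoΠ-conv : ∀ {Γ} (x : Q.F₀ Γ) → E.ΠFam (φ.η x) ≡ E′.ΠFam x
    exoΠ-conv x = proj₁ (conv x)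

    opaque
      at-conv : ∀ {Γ} (x : Q.F₀ Γ) (f : E.ΠFam (φ.η x)) {Δ} (σ : Δ ⇒ Γ) {z : Q.F₀ Δ}
                (e : Q.F₁ σ x ≡ z) (e′ : P.F₁ σ (φ.η x) ≡ φ.η z) (a : A.F₀ (Δ , φ.η z)) →
                E′.At.at x (coe (exoΠ-conv x) f) σ e a ≡ E.At.at (φ.η x) f σ e′ a
      at-conv x f σ e e′ a =
        trans (at-at′ x (coe (exoΠ-conv x) f) σ e (cong φ.η e) a) (proj₂ (conv x) f σ e′ (cong φ.η e) a)

      exoΠ-act : ∀ {Γ Γ′} (ρ : Γ′ ⇒ Γ) {x : Q.F₀ Γ} {x′} (e : Q.F₁ ρ x ≡ x′)
                 (e₀ : P.F₁ ρ (φ.η x) ≡ φ.η x′) (f : E.ΠFam (φ.η x)) →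
                 coe (exoΠ-conv x′) (E.act ρ e₀ f) ≡ E′.act ρ e (coe (exoΠ-conv x) f)
      exoΠ-act ρ {x} {x′} e e₀ f = E′.At.fam-≡ x′ λ σ a →
        let e₁ = φ.natural σ x′
            e₂ = trans (E.act-eq ρ e₀ σ) e₁
        in trans (at-conv x′ (E.act ρ e₀ f) σ refl e₁ a)
          (trans (E.at-act ρ e₀ f σ e₁ e₂ a)
            (sym (at-conv x f (ρ ∘ σ) (E′.act-eq ρ e σ) e₂ a)))

      exoΠ-[]ₚ : reindex φ E.exoΠ ≡ E′.exoΠ
      exoΠ-[]ₚ = psh-≡ (λ (Γ , x) → exoΠ-conv x) (λ (ρ , e) f → exoΠ-act ρ e _ f)

      exoΠ-[]′ : {θ : NatTrans (total Q (reindex φ A)) (total P A)} → θ ≡ liftₚ φ A →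
                 reindex φ E.exoΠ ≡ ExoΠ.exoΠ {Q} (reindex φ A) (reindex θ B)
      exoΠ-[]′ refl = exoΠ-[]ₚ

module PresheafModel (funext : FunExt) {ℓ : Level} (C : CwF ℓ ℓ ℓ ℓ) where
  open Equalities funext
  open CwF C
  open ExoΠTypes funext cat
  private
    Ĉ : CwF (lsuc ℓ) ℓ (lsuc ℓ) ℓ
    Ĉ = presheafCwF funext cat
    module Ĉ = CwF Ĉ

  -- Tyᶠ(P) = Ĉ(P , Ty), and c_P(A)(Γ , x) = Tm(Γ , A_Γ(x)).
  presheafTwoLevel : TwoLevelCwF (lsuc ℓ) ℓ (lsuc ℓ) ℓ ℓ
  presheafTwoLevel .TwoLevelCwF.exo  = Ĉ
  presheafTwoLevel .TwoLevelCwF.tyᶠ  = record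
    { F₀   = λ P → NatTrans P tyPsh
    ; F₁   = λ φ A → A ∘ₙ φ
    ; F-id = λ A → nat-≡ λ x → refl
    ; F-∘  = λ φ ψ A → nat-≡ λ x → refl
    }
  presheafTwoLevel .TwoLevelCwF.conv = record
    { η       = λ A → reindex A tmPsh
    ; natural = λ φ A → sym (reindex-∘ A φ tmPsh)
    }

  open TwoLevelCwF presheafTwoLevel using (fib; conv; c; c-natural)
  private module f = CwF fib

  ℕᵉ : Ĉ.Ty Ĉ.𝟙
  ℕᵉ = record
    { F₀ = λ X → Lift ℓ ℕ ; F₁ = λ f n → n ; F-id = λ n → refl ; F-∘ = λ f g n → refl }

  opaque
    lift≡liftₚ : ∀ {P Q : Presheaf cat ℓ} (φ : NatTrans Q P) (A : Ĉ.Ty P) →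
                 Ĉ.lift⁺ {A = A} φ refl ≡ liftₚ φ A
    lift≡liftₚ {P} {Q} φ A = Ĉ.lift-unique A (reindex φ A) φ refl (liftₚ φ A)
      (nat-≡ λ x → refl) e
      (section-≡ λ X → el-subst e (reindexSection (liftₚ φ A) (var P A)) X refl)
      where
      e : reindex (liftₚ φ A) (reindex (proj P A) A) ≡
          reindex (proj Q (reindex φ A)) (reindex φ A)
      e = psh-≡ (λ X → refl) (λ f a → cong (λ k → Presheaf.F₁ A k a) (∫-≡ P refl))

    exoΠ-[] : ∀ {P Q : Presheaf cat ℓ} (A : Presheaf (∫ P) ℓ) (B : Presheaf (∫ (total P A)) ℓ)
              (φ : NatTrans Q P) →
              reindex φ (ExoΠ.exoΠ {P} A B) ≡
              ExoΠ.exoΠ {Q} (reindex φ A) (reindex (Ĉ.lift⁺ {A = A} φ refl) B)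
    exoΠ-[] A B φ = exoΠ-[]′ φ A B (lift≡liftₚ φ A)

  presheafΠᵉ : ΠFormer Ĉ
  presheafΠᵉ .ΠFormer.Π {P} A B = ExoΠ.exoΠ {P} A B
  presheafΠᵉ .ΠFormer.Π-[] {A = A} {B} φ = exoΠ-[] A B φ

  module _ {P : Presheaf cat ℓ} (A : f.Ty P) where
    private
      module P = Presheaf P
      module A = NatTrans A

    -- (x[p] , q) ∈ (P.A)(Γ.A_Γ(x))
    generic : ∀ {Γ} (x : P.F₀ Γ) → Presheaf.F₀ (P f.▹ A) (Γ ▹ A.η x)
    generic x = P.F₁ (p (A.η x)) x , subst (Tm _) (A.natural (p (A.η x)) x) (q (A.η x))

    opaque
      generic-[] : ∀ {Γ Δ} (σ : Δ ⇒ Γ) (x : P.F₀ Γ) →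
                   Presheaf.F₁ (P f.▹ A) (lift⁺ σ (A.natural σ x)) (generic x) ≡ generic (P.F₁ σ x)
      generic-[] σ x = ▹-act P (c A) (lift⁺ σ (A.natural σ x)) e (go (A.natural _ _) (A.natural _ _) _)
        where
        e : P.F₁ (lift⁺ σ (A.natural σ x)) (P.F₁ (p (A.η x)) x) ≡
            P.F₁ (p (A.η (P.F₁ σ x))) (P.F₁ σ x)
        e = trans (sym (P.F-∘ _ _ x)) (trans (cong (λ τ → P.F₁ τ x) p-lift) (P.F-∘ _ _ x))
        go : ∀ {X Y} (m : A.η x [ p (A.η x) ] ≡ X)
             (n : A.η (P.F₁ σ x) [ p (A.η (P.F₁ σ x)) ] ≡ Y)
             (e : X [ lift⁺ σ (A.natural σ x) ] ≡ Y) →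
             tmSub (lift⁺ σ (A.natural σ x)) e (subst (Tm _) m (q (A.η x))) ≡
             subst (Tm _) n (q (A.η (P.F₁ σ x)))
        go refl refl e = q-ext e

  -- φ⁺ for types: (x , a) ↦ (φ(x) , a).
  liftᶠ : ∀ {P Q : Presheaf cat ℓ} (φ : NatTrans Q P) (A : f.Ty P) →
          NatTrans (Q f.▹ A f.[ φ ]) (P f.▹ A)
  liftᶠ φ A .NatTrans.η (x , a) = NatTrans.η φ x , a
  liftᶠ {P} φ A .NatTrans.natural σ (x , a) =
    ▹-act P (c A) σ (NatTrans.natural φ σ x) (tmSub-cong refl refl)

  opaque
    tmSub-value : ∀ {P Q : Presheaf cat ℓ} {A : NatTrans P tyPsh} {B : NatTrans Q tyPsh} (φ : NatTrans Q P)
                  (e : A ∘ₙ φ ≡ B) (a : Section (reindex A tmPsh)) {Γ} (x : Presheaf.F₀ Q Γ)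
                  (E : NatTrans.η A (NatTrans.η φ x) ≡ NatTrans.η B x) →
                  Section.el (f.tmSub {A = A} φ e a) (Γ , x) ≡
                  subst (Tm Γ) E (Section.el a (Γ , NatTrans.η φ x))
    tmSub-value {A = A} φ e a {Γ} x E = trans
      (el-subst (natural′ conv φ e) (reindexSection φ a) (Γ , x) (cong (Tm Γ) E))
      (go E)
      where
      go : ∀ {X Y} (E : X ≡ Y) {t : Tm Γ X} → coe (cong (Tm Γ) E) t ≡ subst (Tm Γ) E t
      go refl = refl

    q-value : ∀ {P : Presheaf cat ℓ} (A : NatTrans P tyPsh) {Γ} (x : Presheaf.F₀ P Γ)
              (a : Tm Γ (NatTrans.η A x)) → Section.el (f.q A) (Γ , (x , a)) ≡ a
    q-value {P} A {Γ} x a = el-subst (c-natural (proj P (c A)) A) (var P (c A)) (Γ , (x , a)) refl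

    private
      liftᶠ-eq : ∀ {P Q : Presheaf cat ℓ} (φ : NatTrans Q P) (A : NatTrans P tyPsh) →
                 (A ∘ₙ proj P (c A)) ∘ₙ liftᶠ φ A ≡ (A ∘ₙ φ) ∘ₙ proj Q (c (A ∘ₙ φ))
      liftᶠ-eq φ A = nat-≡ λ x → refl

      liftᶠ-q : ∀ {P Q : Presheaf cat ℓ} (φ : NatTrans Q P) (A : NatTrans P tyPsh) →
                f.tmSub {A = A ∘ₙ proj P (c A)} {B = (A ∘ₙ φ) ∘ₙ proj Q (c (A ∘ₙ φ))}
                        (liftᶠ φ A) (liftᶠ-eq φ A) (f.q A) ≡ f.q (A ∘ₙ φ)
      liftᶠ-q {P} {Q} φ A = section-≡ λ (Γ , (x , a)) → trans
        (tmSub-value {A = A ∘ₙ proj P (c A)} {B = (A ∘ₙ φ) ∘ₙ proj Q (c (A ∘ₙ φ))}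
                     (liftᶠ φ A) (liftᶠ-eq φ A) (f.q A) (x , a) refl)
        (trans (q-value A (NatTrans.η φ x) a) (sym (q-value (A ∘ₙ φ) x a)))

    lift≡liftᶠ : ∀ {P Q : Presheaf cat ℓ} (φ : NatTrans Q P) (A : NatTrans P tyPsh) →
                 f.lift⁺ {A = A} φ refl ≡ liftᶠ φ A
    lift≡liftᶠ {P} {Q} φ A = f.lift-unique A (A ∘ₙ φ) φ refl (liftᶠ φ A)
      (nat-≡ λ x → refl) (liftᶠ-eq φ A) (liftᶠ-q φ A)

    liftᶠ-generic : ∀ {P Q : Presheaf cat ℓ} (φ : NatTrans Q P) (A : NatTrans P tyPsh)
                    {Γ} (x : Presheaf.F₀ Q Γ) →
                    NatTrans.η (liftᶠ φ A) (generic (A ∘ₙ φ) x) ≡ generic A (NatTrans.η φ x)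
    liftᶠ-generic {P} {Q} φ A {Γ} x =
      Σ-≡ eφ (go (NatTrans.natural (A ∘ₙ φ) (p (NatTrans.η A (NatTrans.η φ x))) x)
                 (NatTrans.natural A (p (NatTrans.η A (NatTrans.η φ x))) (NatTrans.η φ x)) eφ)
      where
      eφ : NatTrans.η φ (Presheaf.F₁ Q (p (NatTrans.η A (NatTrans.η φ x))) x) ≡
           Presheaf.F₁ P (p (NatTrans.η A (NatTrans.η φ x))) (NatTrans.η φ x)
      eφ = sym (NatTrans.natural φ _ x)
      go : ∀ {Δ X} {x₁ x₂ : Presheaf.F₀ P Δ} {t : Tm Δ X}
           (m : X ≡ NatTrans.η A x₁) (n : X ≡ NatTrans.η A x₂) (e : x₁ ≡ x₂) →
           subst (λ x → Tm Δ (NatTrans.η A x)) e (subst (Tm Δ) m t) ≡ subst (Tm Δ) n t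
      go refl n refl with uip n refl
      ... | refl = refl

  module _ (F : ContrFormers C) where
    open ContrFormers F

    private
      module Pointwise
        (T    : ∀ {Γ} (A : Ty Γ) → Ty (Γ ▹ A) → Ty Γ)
        (T-[] : ∀ {Γ Δ} {A : Ty Γ} {A′} {B : Ty (Γ ▹ A)} {B′} (σ : Δ ⇒ Γ) (e : A [ σ ] ≡ A′) →
                B [ lift⁺ σ e ] ≡ B′ → T A B [ σ ] ≡ T A′ B′) where

        pointwise : ∀ {P : Presheaf cat ℓ} (A : f.Ty P) → f.Ty (P f.▹ A) → f.Ty P
        pointwise {P} A B = record
          { η       = λ x → T (A.η x) (B.η (generic A x))
          ; natural = λ σ x → T-[] σ (A.natural σ x)
              (trans (B.natural (lift⁺ σ (A.natural σ x)) (generic A x))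
                     (cong B.η (generic-[] A σ x)))
          }
          where
          module A = NatTrans A
          module B = NatTrans B

        opaque
          pointwise-[] : ∀ {P Q : Presheaf cat ℓ} {A : f.Ty P} {B : f.Ty (P f.▹ A)} (φ : NatTrans Q P) →
                         pointwise A B f.[ φ ] ≡ pointwise (A f.[ φ ]) (B f.[ f.lift⁺ {A = A} φ refl ])
          pointwise-[] {A = A} {B} φ = nat-≡ λ x →
            cong (λ z → T (NatTrans.η A (NatTrans.η φ x)) z)
              (trans (cong (NatTrans.η B) (sym (liftᶠ-generic φ A x)))
                     (cong (λ ψ → NatTrans.η B (NatTrans.η ψ (generic (A f.[ φ ]) x)))
                           (sym (lift≡liftᶠ φ A))))

    presheafΠ : ΠFormer fib
    presheafΠ = record { Π = pointwise ; Π-[] = pointwise-[] }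
      where open Pointwise Π Π-[]′

    presheafΣ : ΣFormer fib
    presheafΣ = record { Sg = pointwise ; Sg-[] = pointwise-[] }
      where open Pointwise Sg Sg-[]′

    presheafId : IdFormer fib
    presheafId = record
      { Id    = λ {P} A a b → record
          { η       = λ {Γ} x → Id (NatTrans.η A x) (Section.el a (Γ , x)) (Section.el b (Γ , x))
          ; natural = λ σ x → Id-[]′ σ (NatTrans.natural A σ x) (compat′ P A a σ x) (compat′ P A b σ x)
          }
      ; Id-[] = λ {P} {Q} {A} {a} {b} φ → nat-≡ λ {Γ} x →
          cong₂ (Id (NatTrans.η A (NatTrans.η φ x)))
            (sym (tmSub-value φ refl a x refl)) (sym (tmSub-value φ refl b x refl))
      }
      where
      compat′ : ∀ (P : Presheaf cat ℓ) (A : NatTrans P tyPsh) (a : Section (reindex A tmPsh))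
                {Γ Δ} (σ : Δ ⇒ Γ) (x : Presheaf.F₀ P Γ) →
                tmSub σ (NatTrans.natural A σ x) (Section.el a (Γ , x)) ≡
                Section.el a (Δ , Presheaf.F₁ P σ x)
      compat′ P A a σ x = trans (tmSub-cong refl refl) (Section.compat a (σ , refl))

    presheafFormers : CofibFormers presheafTwoLevel
    presheafFormers = record
      { Πᵉ    = presheafΠᵉ
      ; contr = record { Πf = presheafΠ ; Σf = presheafΣ ; Idf = presheafId }
      }

{-# OPTIONS --safe #-}

-- For Y over P.ℕᵉ put Θ(Y)_Γ(x) = Ω_n Y_Γ(x , n).  A family in Πᵉ(ℕᵉ , Y)(Γ , x)
-- is determined by its values at id : Γ → Γ, that is, by a sequence of terms of
-- the types Y_Γ(x , n), because restriction acts trivially on ℕᵉ; so the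
-- bijection φ of the exo-nat products is the isomorphism c(Θ(Y)) ≅ Πᵉ(ℕᵉ , Y).
-- If each Y_n is contractible with centre a_n, the centre of Ω Y is ψ(a), and
-- the contraction at q is obtained from the paths a_n = φ(q)_n in context Γ.Ω Y
-- by clause (2) of exo-nat products, since q = ψ(φ(q)).
module Submission where

open import Level using (Level; _⊔_; lift)
open import Data.Nat.Base using (ℕ)
open import Data.Product using (Σ-syntax; _×_; _,_; proj₁; proj₂)
open import Function.Bundles using (Inverse)
open import Relation.Binary.PropositionalEquality
  using (_≡_; refl; sym; trans; cong; subst; subst₂)
open import Axiom.UniquenessOfIdentityProofs.WithK using (uip)

open import Defs

-- Substitution of terms up to equality of types.

module SubstRel {o h t m : Level} (C : CwF o h t m) where
  open CwF C

  -- a[σ] = a′, where the types A[σ] and A′ need only be propositionally equal.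
  -- With σ = id this is heterogeneous equality of terms.
  infix 4 _⟦_⟧≈_
  record _⟦_⟧≈_ {Γ Δ A A′} (a : Tm Γ A) (σ : Δ ⇒ Γ) (a′ : Tm Δ A′) : Set (t ⊔ m) where
    constructor mk≈
    field
      ty : A [ σ ] ≡ A′
      tm : tmSub σ ty a ≡ a′

  ≈-tm : ∀ {Γ Δ A A′} {a : Tm Γ A} {σ : Δ ⇒ Γ} {a′ : Tm Δ A′} →
         a ⟦ σ ⟧≈ a′ → (e : A [ σ ] ≡ A′) → tmSub σ e a ≡ a′
  ≈-tm (mk≈ _ r) e = trans (tmSub-cong refl refl) r

  ≈-substˡ : ∀ {Γ Δ A B A′} {a : Tm Γ A} {σ : Δ ⇒ Γ} {a′ : Tm Δ A′} (e : A ≡ B) →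
             a ⟦ σ ⟧≈ a′ → subst (Tm Γ) e a ⟦ σ ⟧≈ a′
  ≈-substˡ refl r = r

  ≈-substʳ : ∀ {Γ Δ A A′ B′} {a : Tm Γ A} {σ : Δ ⇒ Γ} {a′ : Tm Δ A′} (e : A′ ≡ B′) →
             a ⟦ σ ⟧≈ a′ → a ⟦ σ ⟧≈ subst (Tm Δ) e a′
  ≈-substʳ refl r = r

  ≈-id : ∀ {Γ A B} {a : Tm Γ A} (e : A ≡ B) → a ⟦ id ⟧≈ subst (Tm Γ) e a
  ≈-id e = ≈-substʳ e (mk≈ ([id] _) (tmSub-id _ _))

  ≈-id⁻ : ∀ {Γ A B} {a : Tm Γ A} {b : Tm Γ B} → a ⟦ id ⟧≈ b →
          (e : A ≡ B) → subst (Tm Γ) e a ≡ b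
  ≈-id⁻ r refl = trans (sym (tmSub-id ([id] _) _)) (≈-tm r ([id] _))

  subst-tmSub : ∀ {Γ Δ A B} {σ : Δ ⇒ Γ} {a : Tm Γ A} (e : A [ σ ] ≡ B) →
                subst (Tm Δ) e (tmSub σ refl a) ≡ tmSub σ e a
  subst-tmSub refl = refl

  ≈-unique : ∀ {Γ Δ A A′} {a : Tm Γ A} {σ : Δ ⇒ Γ} {a′ a″ : Tm Δ A′} →
             a ⟦ σ ⟧≈ a′ → a ⟦ σ ⟧≈ a″ → a′ ≡ a″
  ≈-unique (mk≈ e r) r′ = trans (sym r) (≈-tm r′ e)

  -- By functoriality both sides are `a` substituted along the common composite of the square. This
  -- turns a commuting square of substitutions into naturality of a substituted term; weakening is
  -- the case where the square is `p-lift`.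
  ≈-square : ∀ {Γ Δ Θ Ξ A B B′ D} {α : Δ ⇒ Γ} {τ : Ξ ⇒ Δ} {τ′ : Θ ⇒ Γ} {β : Ξ ⇒ Θ}
             {a : Tm Γ A} {b : Tm Θ B} → α ∘ τ ≡ τ′ ∘ β → a ⟦ τ′ ⟧≈ b →
             (e : A [ α ] ≡ B′) (e′ : B [ β ] ≡ D) → tmSub α e a ⟦ τ ⟧≈ tmSub β e′ b
  ≈-square {A = A} {α = α} {τ} {τ′} {β} {a} sq (mk≈ refl refl) refl refl = mk≈ E
    (trans (sym (tmSub-∘ refl E (trans ([∘] A α τ) E) a))
      (trans (tmSub-cong sq refl) (tmSub-∘ refl refl ([∘] A τ′ β) a)))
    where
    E : A [ α ] [ τ ] ≡ A [ τ′ ] [ β ]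
    E = trans (sym ([∘] A α τ)) (trans (cong (A [_]) sq) ([∘] A τ′ β))

  q-ext-≈ : ∀ {Γ Δ} {A : Ty Γ} {B : Ty Δ} (σ : Δ ⇒ Γ) (e : A [ σ ] ≡ B) (b : Tm Δ B) →
            q A ⟦ ext σ e b ⟧≈ b
  q-ext-≈ σ e b = mk≈ ([p][ext] e) (q-ext _)

  q-lift-≈ : ∀ {Γ Δ} {A : Ty Γ} {A′} (σ : Δ ⇒ Γ) (e : A [ σ ] ≡ A′) → q A ⟦ lift⁺ σ e ⟧≈ q A′
  q-lift-≈ σ e = q-ext-≈ _ _ _

  weaken-≈ : ∀ {Γ Δ} {A X : Ty Γ} {A′ X′} {σ : Δ ⇒ Γ} (e : A [ σ ] ≡ A′)
             {a : Tm Γ X} {a′ : Tm Δ X′} → a ⟦ σ ⟧≈ a′ →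
             tmSub (p A) refl a ⟦ lift⁺ σ e ⟧≈ tmSub (p A′) refl a′
  weaken-≈ e r = ≈-square p-lift r refl refl

  -- Stability of projections, pairing, application and abstraction.

  module _ (S : ΣTypes C) where
    open ΣTypes S

    fst : ∀ {Γ} {A : Ty Γ} {B : Ty (Γ ▹ A)} → Tm Γ (Sg A B) → Tm Γ A
    fst u = proj₁ (Inverse.to split u)

    snd : ∀ {Γ} {A : Ty Γ} {B : Ty (Γ ▹ A)} (u : Tm Γ (Sg A B)) → Tm Γ (B [ ⟪ fst u ⟫ ])
    snd u = proj₂ (Inverse.to split u)

    pair-≈ : ∀ {Γ Δ} {A : Ty Γ} {A′} {B : Ty (Γ ▹ A)} {B′} {σ : Δ ⇒ Γ} (eA : A [ σ ] ≡ A′) →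
             B [ lift⁺ σ eA ] ≡ B′ →
             {a : Tm Γ A} {a′ : Tm Δ A′} {b : Tm Γ (B [ ⟪ a ⟫ ])} {b′ : Tm Δ (B′ [ ⟪ a′ ⟫ ])} →
             a ⟦ σ ⟧≈ a′ → b ⟦ σ ⟧≈ b′ → pair a b ⟦ σ ⟧≈ pair a′ b′
    pair-≈ {σ = σ} refl refl {a} {b = b} ra rb with ≈-tm ra refl
    ... | refl = mk≈ (Sg-[] σ) (trans (pair-[] σ a b)
      (cong (λ z → pair (tmSub σ refl a) z) (≈-tm rb _)))

    private
      -- Stability is given for `pair` alone. By η, `u` is the pair of its projections; substituting
      -- that pair and applying β recovers the substituted projections.
      split-pair : ∀ {Γ Δ} {A : Ty Γ} {A′} {B : Ty (Γ ▹ A)} {B′} {σ : Δ ⇒ Γ} (eA : A [ σ ] ≡ A′) →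
        B [ lift⁺ σ eA ] ≡ B′ → {u : Tm Γ (Sg A B)} {u′ : Tm Δ (Sg A′ B′)} → u ⟦ σ ⟧≈ u′ →
        fst u ⟦ σ ⟧≈ fst u′ × snd u ⟦ σ ⟧≈ snd u′
      split-pair {B = B} {σ = σ} refl refl {u} {u′} r
        with trans (sym (≈-tm r (Sg-[] σ)))
               (trans (cong (tmSub σ (Sg-[] σ)) (sym (Inverse.strictlyInverseʳ split u)))
                      (pair-[] σ (fst u) (snd u)))
      ... | refl rewrite Inverse.strictlyInverseˡ split
                           (tmSub σ refl (fst u) , tmSub σ ([⟪⟫]-natural B refl refl) (snd u))
          = mk≈ refl refl , mk≈ _ refl

    fst-≈ : ∀ {Γ Δ} {A : Ty Γ} {A′} {B : Ty (Γ ▹ A)} {B′} {σ : Δ ⇒ Γ} (eA : A [ σ ] ≡ A′) →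
            B [ lift⁺ σ eA ] ≡ B′ → {u : Tm Γ (Sg A B)} {u′ : Tm Δ (Sg A′ B′)} → u ⟦ σ ⟧≈ u′ →
            fst u ⟦ σ ⟧≈ fst u′
    fst-≈ eA eB r = proj₁ (split-pair eA eB r)

    snd-≈ : ∀ {Γ Δ} {A : Ty Γ} {A′} {B : Ty (Γ ▹ A)} {B′} {σ : Δ ⇒ Γ} (eA : A [ σ ] ≡ A′) →
            B [ lift⁺ σ eA ] ≡ B′ → {u : Tm Γ (Sg A B)} {u′ : Tm Δ (Sg A′ B′)} → u ⟦ σ ⟧≈ u′ →
            snd u ⟦ σ ⟧≈ snd u′
    snd-≈ eA eB r = proj₂ (split-pair eA eB r)

  module _ (S : ΠTypes C) where
    open ΠTypes S

    lam-≈ : ∀ {Γ Δ} {A : Ty Γ} {A′} {B : Ty (Γ ▹ A)} {B′} {σ : Δ ⇒ Γ} (eA : A [ σ ] ≡ A′)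
            {b : Tm (Γ ▹ A) B} {b′ : Tm (Δ ▹ A′) B′} →
            b ⟦ lift⁺ σ eA ⟧≈ b′ → lam b ⟦ σ ⟧≈ lam b′
    lam-≈ {σ = σ} refl {b} (mk≈ refl refl) = mk≈ (Π-[] σ) (lam-[] σ b)

    -- Follows from stability of `lam`: expand `f` as `lam (app f)` by η, substitute, and cancel
    -- `app` against `lam` by β.
    app-≈ : ∀ {Γ Δ} {A : Ty Γ} {A′} {B : Ty (Γ ▹ A)} {B′} {σ : Δ ⇒ Γ} (eA : A [ σ ] ≡ A′) →
            B [ lift⁺ σ eA ] ≡ B′ → {f : Tm Γ (Π A B)} {f′ : Tm Δ (Π A′ B′)} →
            f ⟦ σ ⟧≈ f′ → app f ⟦ lift⁺ σ eA ⟧≈ app f′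
    app-≈ {σ = σ} refl refl {f} r = mk≈ refl (trans
      (sym (Inverse.strictlyInverseˡ curry (tmSub (σ ⁺) refl (app f))))
      (cong app (trans (sym (lam-[] σ (app f))) (trans
        (cong (tmSub σ (Π-[] σ)) (Inverse.strictlyInverseʳ curry f)) (≈-tm r (Π-[] σ))))))

  -- Contractibility as a centre with a contraction.

  module Contr (Ps : ΠTypes C) (Ss : ΣTypes C) (I : IdFormer C) where
    open ΠTypes Ps
    open ΣTypes Ss
    open IdFormer I

    formers : ContrFormers C
    formers = record { Πf = ΠTypes.former Ps ; Σf = ΣTypes.former Ss ; Idf = I }

    open ContrFormers formers using (isContr)

    Id-cong : ∀ {Γ} {A A′ : Ty Γ} {a b : Tm Γ A} {a′ b′} (e : A ≡ A′) →
              subst (Tm Γ) e a ≡ a′ → subst (Tm Γ) e b ≡ b′ → Id A a b ≡ Id A′ a′ b′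
    Id-cong refl refl refl = refl

    -- A family over Γ.A instead of a Π-type, so that a contraction can be pulled back along any
    -- substitution into Γ.A; this is done along `component`.
    PathsFrom : ∀ {Γ} {A : Ty Γ} → Tm Γ A → Ty (Γ ▹ A)
    PathsFrom {A = A} a = Id (A [ p A ]) (tmSub (p A) refl a) (q A)

    PathsFrom-[] : ∀ {Γ Δ} {A : Ty Γ} {A′} {a : Tm Γ A} {a′ : Tm Δ A′} {σ : Δ ⇒ Γ}
                   (eA : A [ σ ] ≡ A′) → a ⟦ σ ⟧≈ a′ → PathsFrom a [ lift⁺ σ eA ] ≡ PathsFrom a′
    PathsFrom-[] {σ = σ} eA ra = Id-[]′ (lift⁺ σ eA) ([p][lift] eA)
      (≈-tm (weaken-≈ eA ra) _) (≈-tm (q-lift-≈ σ eA) _)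

    opaque
      -- Putting `a` for the first variable of `IdFam A` leaves the weakened `a` and the last
      -- variable as endpoints. Hence the second component of a term of `isContr A` corresponds to a
      -- term of `PathsFrom a`.
      Π-IdFam-[⟪⟫] : ∀ {Γ} {A : Ty Γ} (a : Tm Γ A) →
                     Π (A [ p A ]) (IdFam A) [ ⟪ a ⟫ ] ≡ Π A (PathsFrom a)
      Π-IdFam-[⟪⟫] {A = A} a = Π-[]′ ⟪ a ⟫ e (Id-[]′ (lift⁺ ⟪ a ⟫ e) ([p][lift] e)
        (≈-tm (weaken-≈ e (q-ext-≈ id ([id] A) a)) _) (≈-tm (q-lift-≈ ⟪ a ⟫ e) _))
        where
        e : A [ p A ] [ ⟪ a ⟫ ] ≡ A
        e = [p][ext] ([id] A)

    center : ∀ {Γ} {A : Ty Γ} → Tm Γ (isContr A) → Tm Γ A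
    center = fst Ss

    contraction : ∀ {Γ} {A : Ty Γ} (u : Tm Γ (isContr A)) → Tm (Γ ▹ A) (PathsFrom (center u))
    contraction u = app (subst (Tm _) (Π-IdFam-[⟪⟫] (center u)) (snd Ss u))

    contr : ∀ {Γ} {A : Ty Γ} (a : Tm Γ A) → Tm (Γ ▹ A) (PathsFrom a) → Tm Γ (isContr A)
    contr a k = pair a (subst (Tm _) (sym (Π-IdFam-[⟪⟫] a)) (lam k))

    module _ {Γ Δ} {A : Ty Γ} {A′} {σ : Δ ⇒ Γ} (eA : A [ σ ] ≡ A′) where
      private
        eB : Π (A [ p A ]) (IdFam A) [ lift⁺ σ eA ] ≡ Π (A′ [ p A′ ]) (IdFam A′)
        eB = Π-[]′ (lift⁺ σ eA) ([p][lift] eA) (IdFam-[] σ eA)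

      center-≈ : {u : Tm Γ (isContr A)} {u′ : Tm Δ (isContr A′)} →
                 u ⟦ σ ⟧≈ u′ → center u ⟦ σ ⟧≈ center u′
      center-≈ = fst-≈ Ss eA eB

      contraction-≈ : {u : Tm Γ (isContr A)} {u′ : Tm Δ (isContr A′)} →
                      u ⟦ σ ⟧≈ u′ → contraction u ⟦ lift⁺ σ eA ⟧≈ contraction u′
      contraction-≈ r = app-≈ Ps eA (PathsFrom-[] eA (center-≈ r))
        (≈-substˡ _ (≈-substʳ _ (snd-≈ Ss eA eB r)))

      contr-≈ : {a : Tm Γ A} {a′ : Tm Δ A′} {k : Tm (Γ ▹ A) (PathsFrom a)}
                {k′ : Tm (Δ ▹ A′) (PathsFrom a′)} →
                a ⟦ σ ⟧≈ a′ → k ⟦ lift⁺ σ eA ⟧≈ k′ → contr a k ⟦ σ ⟧≈ contr a′ k′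
      contr-≈ ra rk = pair-≈ Ss eA eB ra (≈-substˡ _ (≈-substʳ _ (lam-≈ Ps eA rk)))

    -- Exo-nat products of contractible types.

    module ExoNat (funext : FunExt) (E : ExoNatProducts C I) where
      open ExoNatProducts E

      Ω-[]′ : ∀ {Γ Δ} {Y : ℕ → Ty Γ} {Y′ : ℕ → Ty Δ} (σ : Δ ⇒ Γ) →
              (∀ n → Y n [ σ ] ≡ Y′ n) → Ω Y [ σ ] ≡ Ω Y′
      Ω-[]′ {Y = Y} σ e = trans (Ω-[] σ Y) (cong Ω (funext e))

      module _ {Γ Δ} {Y : ℕ → Ty Γ} {Y′ : ℕ → Ty Δ} {σ : Δ ⇒ Γ} where

        ψ-≈ : (∀ n → Y n [ σ ] ≡ Y′ n) →
              {d : ∀ n → Tm Γ (Y n)} {d′ : ∀ n → Tm Δ (Y′ n)} →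
              (∀ n → d n ⟦ σ ⟧≈ d′ n) → ψ {Y = Y} d ⟦ σ ⟧≈ ψ {Y = Y′} d′
        -- Matching on the two function equalities turns `Y′` and `d′` into the substituted
        -- families, where the strict law `ψ-[]` applies.
        ψ-≈ eY rd with funext eY
        ... | refl with funext (λ n → ≈-tm (rd n) refl)
        ... | refl = mk≈ (Ω-[] σ Y) (ψ-[] σ Y _)

        -- Naturality of `φ` is deduced from that of its inverse: write `u` as `ψ (φ u)`,
        -- substitute, and cancel `φ` against `ψ`.
        φ-≈ : (∀ n → Y n [ σ ] ≡ Y′ n) → {u : Tm Γ (Ω Y)} {u′ : Tm Δ (Ω Y′)} →
              u ⟦ σ ⟧≈ u′ → ∀ n → φ u n ⟦ σ ⟧≈ φ u′ n
        φ-≈ eY {u} r n with funext eY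
        ... | refl = mk≈ refl (cong (λ d → d n) (trans
          (sym (Inverse.strictlyInverseˡ (bij Y′) (λ n → tmSub σ refl (φ u n))))
          (cong φ (trans (sym (ψ-[] σ Y (φ u))) (trans
            (cong (tmSub σ (Ω-[] σ Y)) (Inverse.strictlyInverseʳ (bij Y) u)) (≈-tm r (Ω-[] σ Y)))))))

        Ω-ext-≈ : (∀ n → Y n [ σ ] ≡ Y′ n) →
                  {d c : ∀ n → Tm Γ (Y n)} {d′ c′ : ∀ n → Tm Δ (Y′ n)} →
                  {k : ∀ n → Tm Γ (Id (Y n) (d n) (c n))} {k′ : ∀ n → Tm Δ (Id (Y′ n) (d′ n) (c′ n))} →
                  (∀ n → d n ⟦ σ ⟧≈ d′ n) → (∀ n → c n ⟦ σ ⟧≈ c′ n) → (∀ n → k n ⟦ σ ⟧≈ k′ n) →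
                  Ω-ext d c k ⟦ σ ⟧≈ Ω-ext d′ c′ k′
        Ω-ext-≈ eY rd rc rk with funext eY
        ... | refl with funext (λ n → ≈-tm (rd n) refl) | funext (λ n → ≈-tm (rc n) refl)
        ... | refl | refl with funext (λ n → ≈-tm (rk n) (Id-[] σ))
        ... | refl = mk≈ _ (Ω-ext-[] σ _ _ _)

      module _ {Γ} {Y : ℕ → Ty Γ} (u : ∀ n → Tm Γ (isContr (Y n))) where
        private
          -- The variable of Γ.Ω Y, retyped as an element of the product of the weakened family, so
          -- that `φ` can split it into components.
          generic-Ω : Tm (Γ ▹ Ω Y) (Ω (λ n → Y n [ p (Ω Y) ]))
          generic-Ω = subst (Tm _) (Ω-[] (p (Ω Y)) Y) (q (Ω Y))

        Ω-center : Tm Γ (Ω Y)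
        Ω-center = ψ (λ n → center (u n))

        component : ∀ n → Γ ▹ Ω Y ⇒ Γ ▹ Y n
        component n = ext (p (Ω Y)) refl (φ generic-Ω n)

        component-path : ∀ n → PathsFrom (center (u n)) [ component n ] ≡
          Id (Y n [ p (Ω Y) ]) (tmSub (p (Ω Y)) refl (center (u n))) (φ generic-Ω n)
        component-path n = Id-[]′ (component n) ([p][ext] refl)
          (weaken-ext refl _) (q-ext _)

        component-paths : ∀ n → Tm (Γ ▹ Ω Y)
          (Id (Y n [ p (Ω Y) ]) (tmSub (p (Ω Y)) refl (center (u n))) (φ generic-Ω n))
        component-paths n = tmSub (component n) (component-path n) (contraction (u n))

        -- The left endpoints agree because `ψ` commutes with weakening, the right ones because
        -- `generic-Ω` is `ψ` of its components.
        Ω-path-type : Id (Ω (λ n → Y n [ p (Ω Y) ]))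
                         (ψ (λ n → tmSub (p (Ω Y)) refl (center (u n)))) (ψ (φ generic-Ω)) ≡
                      PathsFrom Ω-center
        Ω-path-type = sym (Id-cong (Ω-[] (p (Ω Y)) Y)
          (trans (subst-tmSub (Ω-[] (p (Ω Y)) Y)) (ψ-[] (p (Ω Y)) Y _))
          (sym (Inverse.strictlyInverseʳ (bij _) generic-Ω)))

        Ω-contraction : Tm (Γ ▹ Ω Y) (PathsFrom Ω-center)
        Ω-contraction = subst (Tm _) Ω-path-type (Ω-ext _ _ component-paths)

        Ω-contr : Tm Γ (isContr (Ω Y))
        Ω-contr = contr Ω-center Ω-contraction

      Ω-contr-≈ : ∀ {Γ Δ} {Y : ℕ → Ty Γ} {Y′ : ℕ → Ty Δ} {σ : Δ ⇒ Γ}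
                  {u : ∀ n → Tm Γ (isContr (Y n))} {u′ : ∀ n → Tm Δ (isContr (Y′ n))} →
                  (∀ n → Y n [ σ ] ≡ Y′ n) → (∀ n → u n ⟦ σ ⟧≈ u′ n) → Ω-contr u ⟦ σ ⟧≈ Ω-contr u′
      Ω-contr-≈ {Y = Y} {Y′} {σ} {u} {u′} eY ru = contr-≈ eΩ (ψ-≈ eY rc)
        (≈-substˡ _ (≈-substʳ _ (Ω-ext-≈ (λ n → [p][lift] (eY n))
          (λ n → weaken-≈ eΩ (rc n)) rφ
          -- The components of the generic element correspond under the lift of `σ`, so
          -- `component n` commutes with the lifts; the paths pulled back along it therefore
          -- correspond too.
          (λ n → ≈-square (ext-p-natural (_⟦_⟧≈_.ty (rφ n)) (_⟦_⟧≈_.tm (rφ n)))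
            (contraction-≈ (eY n) (ru n))
            (component-path u n) (component-path u′ n)))))
        where
        eΩ : Ω Y [ σ ] ≡ Ω Y′
        eΩ = Ω-[]′ σ eY
        rc : ∀ n → center (u n) ⟦ σ ⟧≈ center (u′ n)
        rc n = center-≈ (eY n) (ru n)
        rφ = φ-≈ (λ n → [p][lift] (eY n)) (≈-substˡ _ (≈-substʳ _ (q-lift-≈ σ eΩ)))

-- A way to construct Cofibrant that is usable at the presheaf model.  There,
-- judgemental comparison of two substituted types η-expands presheaves and
-- natural transformations and does not terminate in reasonable time; hence the
-- opaque names, and hence σ∘τ and [τ]⁺ are replaced by variables ρ and τ⁺.
module CofibrantIntro {o h t m t′ : Level} (D : TwoLevelCwF o h t m t′) (F : CofibFormers D) where
  open TwoLevelCwF D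
  open CwF exo
  private module f = CwF fib
  open CofibFormers F
  open ΠFormer Πᵉ
  open ContrFormers contr using (isContr)

  opaque
    isContrᶠ : ∀ {Γ} → f.Ty Γ → f.Ty Γ
    isContrᶠ = isContr

    Tmᶠ : ∀ Γ → f.Ty Γ → Set m
    Tmᶠ = f.Tm

    Pull : ∀ {Γ Δ} (τ : Δ ⇒ Γ) → f.Ty Γ → f.Ty Δ → Set t′
    Pull τ Y Z = Y f.[ τ ] ≡ Z

    substTm : ∀ {Γ Δ} {Y : f.Ty Γ} {Z : f.Ty Δ} (τ : Δ ⇒ Γ) → Pull τ Y Z → Tmᶠ Γ Y → Tmᶠ Δ Z
    substTm = f.tmSub

  module _ {Γ : Ob} (A : Ty Γ) where

    Ext : ∀ {Δ} → Δ ⇒ Γ → Ob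
    Ext {Δ} σ = Δ ▹ A [ σ ]

    IsLift : ∀ {Δ Υ} (σ : Δ ⇒ Γ) (ρ : Υ ⇒ Γ) (τ : Υ ⇒ Δ) → Ext ρ ⇒ Ext σ → Set _
    IsLift σ ρ τ τ⁺ = Σ[ e ∈ A [ σ ] [ τ ] ≡ A [ ρ ] ] lift⁺ τ e ≡ τ⁺

    opaque
      unfolding isContrᶠ

      cofibrant :
        (Θ : ∀ {Δ} (σ : Δ ⇒ Γ) → f.Ty (Ext σ) → f.Ty Δ)
        (iso : ∀ {Δ} (σ : Δ ⇒ Γ) (Y : f.Ty (Ext σ)) → TyIso exo (c (Θ σ Y)) (Π (A [ σ ]) (c Y)))
        (Θᵀᵐ : ∀ {Δ} (σ : Δ ⇒ Γ) (Y : f.Ty (Ext σ)) →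
               Tmᶠ (Ext σ) (isContrᶠ Y) → Tmᶠ Δ (isContrᶠ (Θ σ Y))) →
        (∀ {Δ Υ} (σ : Δ ⇒ Γ) (ρ : Υ ⇒ Γ) (τ : Υ ⇒ Δ) (τ⁺ : Ext ρ ⇒ Ext σ) → IsLift σ ρ τ τ⁺ →
           ∀ Y Y′ → Pull τ⁺ Y Y′ → Pull τ (Θ σ Y) (Θ ρ Y′)) →
        (∀ {Δ Υ} (σ : Δ ⇒ Γ) (ρ : Υ ⇒ Γ) (τ : Υ ⇒ Δ) (τ⁺ : Ext ρ ⇒ Ext σ) → IsLift σ ρ τ τ⁺ →
           ∀ Y Y′ → Pull τ⁺ Y Y′ →
           (eΘ : c (Θ σ Y) [ τ ] ≡ c (Θ ρ Y′)) (eΠ : Π (A [ σ ]) (c Y) [ τ ] ≡ Π (A [ ρ ]) (c Y′)) →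
           TyIso.to (iso σ Y) ∘ lift⁺ τ eΘ ≡ lift⁺ τ eΠ ∘ TyIso.to (iso ρ Y′)) →
        (∀ {Δ Υ} (σ : Δ ⇒ Γ) (ρ : Υ ⇒ Γ) (τ : Υ ⇒ Δ) (τ⁺ : Ext ρ ⇒ Ext σ) → IsLift σ ρ τ τ⁺ →
           ∀ Y Y′ → Pull τ⁺ Y Y′ →
           (eΘ : Pull τ (isContrᶠ (Θ σ Y)) (isContrᶠ (Θ ρ Y′))) (eY : Pull τ⁺ (isContrᶠ Y) (isContrᶠ Y′))
           (h : Tmᶠ (Ext σ) (isContrᶠ Y)) → substTm τ eΘ (Θᵀᵐ σ Y h) ≡ Θᵀᵐ ρ Y′ (substTm τ⁺ eY h)) →
        Cofibrant D F A
      cofibrant Θ iso Θᵀᵐ Θ-[] iso-[] Θᵀᵐ-[] = record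
        { Θᵀʸ         = Θ
        ; Θᵀʸ-natural = λ σ τ Y → Θ-[] σ (σ ∘ τ) τ _ (_ , refl) Y _ refl
        ; iso         = iso
        ; iso-natural = λ σ τ Y → iso-[] σ (σ ∘ τ) τ _ (_ , refl) Y _ refl _ _
        ; Θᵀᵐ         = Θᵀᵐ
        ; Θᵀᵐ-natural = λ σ τ Y h → Θᵀᵐ-[] σ (σ ∘ τ) τ _ (_ , refl) Y _ refl _ _ h
        }

-- The presheaf model: context lifts and exo-Π families evaluated pointwise.

module NatCofibrant (funext : FunExt) {ℓ : Level} (C : CwF ℓ ℓ ℓ ℓ) (T : TypeFormers C)
                    (E : ExoNatProducts C (IdTypes.former (TypeFormers.Ids T))) where
  open CwF C
  open TypeFormers T using (Πs; Σs; Ids; contrFormers)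
  open ContrFormers contrFormers
  open SubstRel C
  open Contr.ExoNat Πs Σs (IdTypes.former Ids) funext E
  open ExoNatProducts E
  open Equalities funext
  open ExoΠTypes funext cat
  open PresheafModel funext C
  open TwoLevelCwF presheafTwoLevel using (fib; c; c-natural)
  open CofibrantIntro presheafTwoLevel (presheafFormers contrFormers)
  private
    module Ĉ = CwF (presheafCwF funext cat)
    module f = CwF fib

  opaque
    lift-value : ∀ {P Q : Presheaf cat ℓ} (τ : NatTrans Q P) {A : Ĉ.Ty P} {A′ : Ĉ.Ty Q}
                 (e : A Ĉ.[ τ ] ≡ A′) {Γ} {x : Presheaf.F₀ Q Γ}
                 {a : Presheaf.F₀ A (Γ , NatTrans.η τ x)} {a′ : Presheaf.F₀ A′ (Γ , x)}
                 (E : Presheaf.F₀ A (Γ , NatTrans.η τ x) ≡ Presheaf.F₀ A′ (Γ , x)) →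
                 coe E a ≡ a′ → NatTrans.η (Ĉ.lift⁺ {A = A} {A′} τ e) (x , a′) ≡ (NatTrans.η τ x , a)
    lift-value τ {A} refl {x = x} {a} E refl =
      trans (cong (λ θ → NatTrans.η θ (x , coe E a)) (lift≡liftₚ τ A))
            (cong (NatTrans.η τ x ,_) (coe-uip E a))

    -- Reduces naturality of a map of extended contexts to an equation in each fibre. The coercions
    -- are arbitrary, since by uniqueness of identity proofs any two of them agree.
    lift-natural : ∀ {P Q : Presheaf cat ℓ} (τ : NatTrans Q P) {A B : Ĉ.Ty P} {A′ B′ : Ĉ.Ty Q}
      (eA : A Ĉ.[ τ ] ≡ A′) (eB : B Ĉ.[ τ ] ≡ B′)
      (s : NatTrans (P Ĉ.▹ A) (P Ĉ.▹ B)) (s′ : NatTrans (Q Ĉ.▹ A′) (Q Ĉ.▹ B′))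
      (g : ∀ {Γ} x → Presheaf.F₀ A (Γ , x) → Presheaf.F₀ B (Γ , x))
      (g′ : ∀ {Γ} x → Presheaf.F₀ A′ (Γ , x) → Presheaf.F₀ B′ (Γ , x)) →
      (∀ {Γ} (x : Presheaf.F₀ P Γ) a → NatTrans.η s (x , a) ≡ (x , g x a)) →
      (∀ {Γ} (x : Presheaf.F₀ Q Γ) a → NatTrans.η s′ (x , a) ≡ (x , g′ x a)) →
      (∀ {Γ} (x : Presheaf.F₀ Q Γ) EA EB a → coe EB (g (NatTrans.η τ x) a) ≡ g′ x (coe EA a)) →
      s ∘ₙ Ĉ.lift⁺ {A = A} {A′} τ eA ≡ Ĉ.lift⁺ {A = B} {B′} τ eB ∘ₙ s′
    lift-natural τ {A} {B} {A′} {B′} eA eB s s′ g g′ es es′ eg = nat-≡ go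
      where
      coe-sym : ∀ {X Y : Set ℓ} (E : X ≡ Y) (y : Y) → coe E (coe (sym E) y) ≡ y
      coe-sym refl y = refl
      go : ∀ {Γ} (z : Presheaf.F₀ (_ Ĉ.▹ A′) Γ) →
           NatTrans.η s (NatTrans.η (Ĉ.lift⁺ {A = A} {A′} τ eA) z) ≡
           NatTrans.η (Ĉ.lift⁺ {A = B} {B′} τ eB) (NatTrans.η s′ z)
      -- `a′` is written as `coe EA` of an element over `τ x`, the form that `lift-value` and `eg`
      -- accept.
      go {Γ} (x , a′) = trans (cong (NatTrans.η s) (lift-value τ eA EA (coe-sym EA a′)))
        (trans (es _ _) (sym (trans (cong (NatTrans.η (Ĉ.lift⁺ {A = B} {B′} τ eB)) (es′ x a′))
          (lift-value τ eB EB (trans (eg x EA EB _) (cong (g′ x) (coe-sym EA a′)))))))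
        where
        EA : Presheaf.F₀ A (Γ , NatTrans.η τ x) ≡ Presheaf.F₀ A′ (Γ , x)
        EA = cong (λ X → Presheaf.F₀ X (Γ , x)) eA
        EB : Presheaf.F₀ B (Γ , NatTrans.η τ x) ≡ Presheaf.F₀ B′ (Γ , x)
        EB = cong (λ X → Presheaf.F₀ X (Γ , x)) eB

    at-coe : ∀ {P Q : Presheaf cat ℓ} (τ : NatTrans Q P) (A : Ĉ.Ty P) {A′ : Ĉ.Ty Q}
      (B : Ĉ.Ty (P Ĉ.▹ A)) {B′ : Ĉ.Ty (Q Ĉ.▹ A′)} (eA : A Ĉ.[ τ ] ≡ A′) →
      B Ĉ.[ Ĉ.lift⁺ {A = A} {A′} τ eA ] ≡ B′ →
      ∀ {Γ} (x : Presheaf.F₀ Q Γ)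
      (EΠ : ExoΠ.ΠFam {P} A B (NatTrans.η τ x) ≡ ExoΠ.ΠFam {Q} A′ B′ x)
      (f : ExoΠ.ΠFam {P} A B (NatTrans.η τ x)) {Δ} (σ : Δ ⇒ Γ) {z : Presheaf.F₀ Q Δ}
      (e : Presheaf.F₁ Q σ x ≡ z) (e′ : Presheaf.F₁ P σ (NatTrans.η τ x) ≡ NatTrans.η τ z)
      {a : Presheaf.F₀ A (Δ , NatTrans.η τ z)} {a′ : Presheaf.F₀ A′ (Δ , z)}
      (EA : Presheaf.F₀ A (Δ , NatTrans.η τ z) ≡ Presheaf.F₀ A′ (Δ , z)) → coe EA a ≡ a′ →
      (EB : Presheaf.F₀ B (Δ , (NatTrans.η τ z , a)) ≡ Presheaf.F₀ B′ (Δ , (z , a′))) →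
      ExoΠ.At.at {Q} A′ B′ x (coe EΠ f) σ e a′ ≡
      coe EB (ExoΠ.At.at {P} A B (NatTrans.η τ x) f σ e′ a)
    at-coe {P} {Q} τ A B refl refl x EΠ f σ {z} e e′ {a} EA refl EB =
      go (lift≡liftₚ τ A) EΠ (coe-uip EA a) EB
      where
      go : ∀ {θ a′} → θ ≡ liftₚ τ A →
           (EΠ : ExoΠ.ΠFam {P} A B (NatTrans.η τ x) ≡ ExoΠ.ΠFam {Q} (reindex τ A) (reindex θ B) x) →
           a′ ≡ a →
           (EB : Presheaf.F₀ B (_ , (NatTrans.η τ z , a)) ≡ Presheaf.F₀ B (_ , NatTrans.η θ (z , a′))) →
           ExoΠ.At.at {Q} (reindex τ A) (reindex θ B) x (coe EΠ f) σ e a′ ≡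
           coe EB (ExoΠ.At.at {P} A B (NatTrans.η τ x) f σ e′ a)
      go refl EΠ refl EB = trans
        -- The arbitrary equality `EΠ` is exchanged for `exoΠ-conv`, whose effect on values is known
        -- from `at-conv`.
        (cong (λ E → ExoΠ.At.at {Q} (reindex τ A) (reindex (liftₚ τ A) B) x (coe E f) σ e a)
              (uip EΠ (exoΠ-conv τ A B x)))
        (trans (at-conv τ A B x f σ e e′ a) (sym (coe-uip EB _)))

  -- `isContr` and terms of the second level, pointwise.

  opaque
    unfolding CofibrantIntro.isContrᶠ

    -- The inherited formers are evaluated at generic elements, whose variables are transported
    -- along naturality of `Y`. Once these equalities are matched to `refl`, both sides are built
    -- from the same variables.
    isContr-value : ∀ {P : Presheaf cat ℓ} (Y : f.Ty P) {Γ} (x : Presheaf.F₀ P Γ) →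
                    NatTrans.η (isContrᶠ Y) x ≡ isContr (NatTrans.η Y x)
    isContr-value {P} Y {Γ} x = cong (Sg (Y.η x))
      (go (Y.natural (p (Y.η x)) x) (NatTrans.natural Y[p] (p A₁) g)
        _ _
        (trans (tmSub-value {A = Y[p]} (f.p Y[p]) refl (f.q Y) gg refl)
          (trans (q-value Y (proj₁ (proj₁ gg)) (proj₂ (proj₁ gg))) (tmSub-cong refl refl)))
        (q-value Y[p] (proj₁ gg) (proj₂ gg)))
      where
      module Y = NatTrans Y
      Y[p] : f.Ty (P f.▹ Y)
      Y[p] = Y f.[ f.p Y ]
      g : Presheaf.F₀ (P f.▹ Y) (Γ ▹ Y.η x)
      g = generic Y x
      A₁ : Ty (Γ ▹ Y.η x)
      A₁ = NatTrans.η Y[p] g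
      gg : Presheaf.F₀ (P f.▹ Y f.▹ Y[p]) (Γ ▹ Y.η x ▹ A₁)
      gg = generic Y[p] g
      go : ∀ {A₁} (m : Y.η x [ p (Y.η x) ] ≡ A₁) {A₂} (n : A₁ [ p A₁ ] ≡ A₂) (t u : Tm _ A₂) →
           t ≡ tmSub (p A₁) n (subst (Tm _) m (q (Y.η x))) → u ≡ subst (Tm _) n (q A₁) →
           Π A₁ (Id A₂ t u) ≡ Π (Y.η x [ p (Y.η x) ]) (IdFam (Y.η x))
      go refl refl _ _ refl refl = refl

  module _ {P : Presheaf cat ℓ} {A : f.Ty P} where
    opaque
      unfolding CofibrantIntro.Tmᶠ

      el : Tmᶠ P A → ∀ {Γ} (x : Presheaf.F₀ P Γ) → Tm Γ (NatTrans.η A x)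
      el a x = Section.el a (_ , x)

      el-≈ : (a : Tmᶠ P A) {Γ Δ : Ob} (σ : Δ ⇒ Γ) (x : Presheaf.F₀ P Γ) {y : Presheaf.F₀ P Δ} →
             Presheaf.F₁ P σ x ≡ y → el a x ⟦ σ ⟧≈ el a y
      el-≈ a σ x e = mk≈ _ (Section.compat a (σ , e))

      section : (g : ∀ {Γ} (x : Presheaf.F₀ P Γ) → Tm Γ (NatTrans.η A x)) →
                (∀ {Γ Δ} (σ : Δ ⇒ Γ) x → g x ⟦ σ ⟧≈ g (Presheaf.F₁ P σ x)) → Tmᶠ P A
      section g r .Section.el (Γ , x) = g x
      section g r .Section.compat {Γ , x} (σ , refl) = ≈-tm (r σ x) _

      el-section : (g : ∀ {Γ} (x : Presheaf.F₀ P Γ) → Tm Γ (NatTrans.η A x))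
                   (r : ∀ {Γ Δ} (σ : Δ ⇒ Γ) x → g x ⟦ σ ⟧≈ g (Presheaf.F₁ P σ x)) →
                   ∀ {Γ} (x : Presheaf.F₀ P Γ) → el (section g r) x ≡ g x
      el-section g r x = refl

      el-injective : (a b : Tmᶠ P A) → (∀ {Γ} (x : Presheaf.F₀ P Γ) → el a x ≡ el b x) → a ≡ b
      el-injective a b e = section-≡ λ (Γ , x) → e x

  opaque
    unfolding CofibrantIntro.Tmᶠ el

    -- The point `w` is kept free because `τ⁺` computes on points only up to propositional equality.
    el-substTm : ∀ {P Q : Presheaf cat ℓ} {A : f.Ty P} {B : f.Ty Q} (φ : NatTrans Q P)
                 (e : Pull φ A B) (a : Tmᶠ P A) {Γ} (x : Presheaf.F₀ Q Γ) {w} → NatTrans.η φ x ≡ w →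
                 el a w ⟦ id ⟧≈ el (substTm φ e a) x
    el-substTm {A = A} {B} φ e a {Γ} x refl =
      subst (Section.el a (Γ , NatTrans.η φ x) ⟦ id ⟧≈_)
        (sym (tmSub-value {A = A} {B} φ e a x eq)) (≈-id eq)
      where
      eq : NatTrans.η A (NatTrans.η φ x) ≡ NatTrans.η B x
      eq = cong (λ Z → NatTrans.η Z x) e

    pull : ∀ {P Q : Presheaf cat ℓ} {A : f.Ty P} {B : f.Ty Q} (φ : NatTrans Q P) →
           (∀ {Γ} (x : Presheaf.F₀ Q Γ) → NatTrans.η A (NatTrans.η φ x) ≡ NatTrans.η B x) → Pull φ A B
    pull φ e = nat-≡ e

    pull⁻ : ∀ {P Q : Presheaf cat ℓ} {A : f.Ty P} {B : f.Ty Q} {φ : NatTrans Q P} → Pull φ A B →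
            A ∘ₙ φ ≡ B
    pull⁻ e = e

  -- The isomorphism and the contractibility operation over a fixed context.

  module _ {P : Presheaf cat ℓ} (σ : NatTrans P Ĉ.𝟙) (Y : f.Ty (Ext ℕᵉ σ)) where
    private
      module P = Presheaf P
      module Y = NatTrans Y
      N : Ĉ.Ty P
      N = ℕᵉ Ĉ.[ σ ]
      module Πᵉ = ExoΠ {P} N (c Y)

    fibre : ∀ {Γ} → P.F₀ Γ → ℕ → Ty Γ
    fibre x n = Y.η (x , lift n)

    fibre-[] : ∀ {Γ Δ} (τ : Δ ⇒ Γ) (x : P.F₀ Γ) n → fibre x n [ τ ] ≡ fibre (P.F₁ τ x) n
    fibre-[] τ x n = Y.natural τ (x , lift n)

    ΩTy : f.Ty P
    ΩTy .NatTrans.η x         = Ω (fibre x)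
    ΩTy .NatTrans.natural τ x = Ω-[]′ τ (fibre-[] τ x)

    sequence : ∀ {Γ} (x : P.F₀ Γ) → Tm Γ (Ω (fibre x)) → Πᵉ.ΠFam x
    sequence x t =
        (λ τ (lift n) → tmSub τ (fibre-[] τ x n) (φ t n))
      , (λ τ υ n → sym (tmSub-∘ _ _ _ _))

    at-sequence : ∀ {Γ} (x : P.F₀ Γ) (t : Tm Γ (Ω (fibre x))) {Δ} (τ : Δ ⇒ Γ) {z}
                  (e : P.F₁ τ x ≡ z) n (e′ : fibre x n [ τ ] ≡ fibre z n) →
                  Πᵉ.At.at x (sequence x t) τ e (lift n) ≡ tmSub τ e′ (φ t n)
    at-sequence x t τ refl n e′ = tmSub-cong refl refl

    value : ∀ {Γ} (x : P.F₀ Γ) → Πᵉ.ΠFam x → ∀ n → Tm Γ (fibre x n)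
    value x f n = Πᵉ.At.at x f id (P.F-id x) (lift n)

    -- Compatibility of `f` with restriction sends its value at `id` to its value at `id ∘ τ`, which
    -- is `τ`. The index stays `lift n` because `ℕᵉ` is constant.
    at-value : ∀ {Γ} (x : P.F₀ Γ) (f : Πᵉ.ΠFam x) {Δ} (τ : Δ ⇒ Γ) n →
               tmSub τ (fibre-[] τ x n) (value x f n) ≡ Πᵉ.At.at x f τ refl (lift n)
    at-value x f τ n = trans (tmSub-cong refl refl) (trans
      (Πᵉ.At.at-nat x f id τ (P.F-id x) refl e (lift n) refl)
      (Πᵉ.At.at-cong x f e refl (lift n) (idˡ τ)))
      where
      e : P.F₁ (id ∘ τ) x ≡ P.F₁ τ x
      e = cong (λ υ → P.F₁ υ x) (idˡ τ)

    toΠᵉ : NatTrans (P Ĉ.▹ c ΩTy) (P Ĉ.▹ Πᵉ.exoΠ)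
    toΠᵉ .NatTrans.η (x , t) = x , sequence x t
    toΠᵉ .NatTrans.natural τ (x , t) = ▹-act P Πᵉ.exoΠ τ refl
      (Πᵉ.At.fam-≡ (P.F₁ τ x) λ υ (lift n) →
        trans (at-sequence x t (τ ∘ υ) (Πᵉ.act-eq τ refl υ) n
                (trans ([∘] _ τ υ) (trans (cong _[ υ ] (fibre-[] τ x n)) (fibre-[] υ _ n))))
          (trans (tmSub-∘ (fibre-[] τ x n) (fibre-[] υ _ n) _ (φ t n))
            (cong (tmSub υ (fibre-[] υ _ n))
              (≈-tm (φ-≈ (fibre-[] τ x) (mk≈ _ refl) n) (fibre-[] τ x n)))))

    fromΠᵉ : NatTrans (P Ĉ.▹ Πᵉ.exoΠ) (P Ĉ.▹ c ΩTy)
    fromΠᵉ .NatTrans.η (x , f) = x , ψ (value x f)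
    fromΠᵉ .NatTrans.natural τ (x , f) = ▹-act P (c ΩTy) τ refl
      -- Both sequences consist of values of `f`: restricting its values at `id` gives those at `τ`,
      -- while restricting `f` first gives those at `τ ∘ id`.
      (≈-tm (ψ-≈ (fibre-[] τ x) λ n → mk≈ (fibre-[] τ x n) (trans (at-value x f τ n) (sym
        (trans (Πᵉ.at-act τ refl f id (P.F-id _) e (lift n))
          (Πᵉ.At.at-cong x f e refl (lift n) (idʳ τ)))))) _)
      where
      e : P.F₁ (τ ∘ id) x ≡ P.F₁ τ x
      e = cong (λ υ → P.F₁ υ x) (idʳ τ)

    Ω≅Πᵉ : TyIso (presheafCwF funext cat) (c ΩTy) Πᵉ.exoΠ
    Ω≅Πᵉ = record
      { to      = toΠᵉ
      ; from    = fromΠᵉ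
      ; p∘to    = nat-≡ λ x → refl
      ; p∘from  = nat-≡ λ x → refl
      ; to∘from = nat-≡ λ (x , f) → cong (x ,_) (Πᵉ.At.fam-≡ x λ τ (lift n) →
          trans (cong (λ d → tmSub τ (fibre-[] τ x n) (d n))
                      (Inverse.strictlyInverseˡ (bij _) (value x f)))
            (at-value x f τ n))
      ; from∘to = nat-≡ λ (x , t) → cong (x ,_) (trans
          (cong ψ (funext λ n → trans (at-sequence x t id (P.F-id x) n ([id] _)) (tmSub-id _ _)))
          (Inverse.strictlyInverseʳ (bij _) t))
      }

    componentContr : Tmᶠ (Ext ℕᵉ σ) (isContrᶠ Y) →
                     ∀ {Γ} (x : P.F₀ Γ) n → Tm Γ (isContr (fibre x n))
    componentContr h x n = subst (Tm _) (isContr-value Y (x , lift n)) (el h (x , lift n))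

    ΩContr-at : Tmᶠ (Ext ℕᵉ σ) (isContrᶠ Y) → ∀ {Γ} (x : P.F₀ Γ) → Tm Γ (NatTrans.η (isContrᶠ ΩTy) x)
    ΩContr-at h x = subst (Tm _) (sym (isContr-value ΩTy x)) (Ω-contr (componentContr h x))

    ΩContr-at-≈ : ∀ h {Γ Δ} (τ : Δ ⇒ Γ) x → ΩContr-at h x ⟦ τ ⟧≈ ΩContr-at h (P.F₁ τ x)
    ΩContr-at-≈ h τ x = ≈-substˡ (sym (isContr-value ΩTy x))
      (≈-substʳ (sym (isContr-value ΩTy (P.F₁ τ x))) (Ω-contr-≈ (fibre-[] τ x) λ n → ≈-substˡ (isContr-value Y (x , lift n))
        (≈-substʳ (isContr-value Y (P.F₁ τ x , lift n)) (el-≈ h τ (x , lift n) refl))))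

    ΩContr : Tmᶠ (Ext ℕᵉ σ) (isContrᶠ Y) → Tmᶠ P (isContrᶠ ΩTy)
    ΩContr h = section (ΩContr-at h) (ΩContr-at-≈ h)

  -- Naturality under substitution along `τ`.

  module _ {P Q : Presheaf cat ℓ} (σ : NatTrans P Ĉ.𝟙) (ρ : NatTrans Q Ĉ.𝟙) (τ : NatTrans Q P)
           (τ⁺ : NatTrans (Ext ℕᵉ ρ) (Ext ℕᵉ σ))
           (isLift : IsLift ℕᵉ σ ρ τ τ⁺)
           (Y : f.Ty (Ext ℕᵉ σ)) (Y′ : f.Ty (Ext ℕᵉ ρ))
           (eY : Pull τ⁺ Y Y′) where
    private
      module Q = Presheaf Q
      module τ = NatTrans τ

    τ⁺-value : ∀ {Γ} (x : Q.F₀ Γ) n → NatTrans.η τ⁺ (x , n) ≡ (τ.η x , n)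
    τ⁺-value x n = trans (cong (λ θ → NatTrans.η θ (x , n)) (sym (proj₂ isLift)))
      (lift-value τ {ℕᵉ Ĉ.[ σ ]} {ℕᵉ Ĉ.[ ρ ]} (proj₁ isLift) refl refl)

    fibre-τ : ∀ {Γ} (x : Q.F₀ Γ) n → fibre σ Y (τ.η x) n ≡ fibre ρ Y′ x n
    fibre-τ x n = trans (cong (NatTrans.η Y) (sym (τ⁺-value x (lift n))))
                        (cong (λ Z → NatTrans.η Z (x , lift n)) (pull⁻ eY))

    ΩTy-[] : Pull {P} {Q} τ (ΩTy σ Y) (ΩTy ρ Y′)
    ΩTy-[] = pull τ λ x → cong Ω (funext (fibre-τ x))

    -- Phrased as substitution along `id`, so that `φ-≈` and `Ω-contr-≈` cover a change of presheaf
    -- context as well as restriction in the base category.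
    fibre-id : ∀ {Γ} (x : Q.F₀ Γ) n → fibre σ Y (τ.η x) n [ id ] ≡ fibre ρ Y′ x n
    fibre-id x n = trans ([id] _) (fibre-τ x n)

    -- Families are compared at each `υ` and `n`. There `at-coe` moves the coercion onto single
    -- terms, and what remains is naturality of `φ` along `id`, restricted along `υ`.
    sequence-[] : ∀ {Γ} (x : Q.F₀ Γ)
      (EΩ : Tm Γ (Ω (fibre σ Y (τ.η x))) ≡ Tm Γ (Ω (fibre ρ Y′ x)))
      (EΠ : ExoΠ.ΠFam {P} (ℕᵉ Ĉ.[ σ ]) (c Y) (τ.η x) ≡ ExoΠ.ΠFam {Q} (ℕᵉ Ĉ.[ ρ ]) (c Y′) x) t →
      coe EΠ (sequence σ Y (τ.η x) t) ≡ sequence ρ Y′ x (coe EΩ t)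
    sequence-[] {Γ} x EΩ EΠ t = ExoΠ.At.fam-≡ {Q} (ℕᵉ Ĉ.[ ρ ]) (c Y′) x λ {Δ} υ (lift n) →
      trans (at-coe τ (ℕᵉ Ĉ.[ σ ]) {ℕᵉ Ĉ.[ ρ ]} (c Y) {c Y′} (proj₁ isLift) eB x EΠ
               (sequence σ Y (τ.η x) t) υ refl (τ.natural υ x) refl refl (cong (Tm Δ) (fibre-τ _ n)))
        (trans (coe-Tm (fibre-τ _ n) (cong (Tm Δ) (fibre-τ _ n)) _)
          (≈-id⁻ (subst (_⟦ id ⟧≈ tmSub υ (fibre-[] ρ Y′ υ x n) (φ (coe EΩ t) n))
                   (sym (at-sequence σ Y (τ.η x) t υ (τ.natural υ x) n (e υ n)))
                   (≈-square (trans (idʳ υ) (sym (idˡ υ))) (φ-≈ (fibre-id x) t≈ n) (e υ n) _))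
                 (fibre-τ _ n)))
      where
      eB : c Y Ĉ.[ Ĉ.lift⁺ {A = ℕᵉ Ĉ.[ σ ]} {ℕᵉ Ĉ.[ ρ ]} τ (proj₁ isLift) ] ≡ c Y′
      eB = trans (cong (c Y Ĉ.[_]) (proj₂ isLift)) (trans (c-natural τ⁺ Y) (cong c (pull⁻ eY)))
      e : ∀ {Δ} (υ : Δ ⇒ Γ) n → fibre σ Y (τ.η x) n [ υ ] ≡ fibre σ Y (τ.η (Q.F₁ υ x)) n
      e υ n = trans (fibre-[] σ Y υ (τ.η x) n) (cong (λ z → fibre σ Y z n) (τ.natural υ x))
      coe-Tm : ∀ {Δ A B} (e : A ≡ B) (E : Tm Δ A ≡ Tm Δ B) a → coe E a ≡ subst (Tm Δ) e a
      coe-Tm refl E a = coe-uip E a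
      eΩ : Ω (fibre σ Y (τ.η x)) ≡ Ω (fibre ρ Y′ x)
      eΩ = cong Ω (funext (fibre-τ x))
      t≈ : t ⟦ id ⟧≈ coe EΩ t
      t≈ = subst (t ⟦ id ⟧≈_) (sym (coe-Tm eΩ EΩ t)) (≈-id eΩ)

    ΩContr-[] : (eΩ : Pull {P} {Q} τ (isContrᶠ (ΩTy σ Y)) (isContrᶠ (ΩTy ρ Y′)))
                (eC : Pull τ⁺ (isContrᶠ Y) (isContrᶠ Y′)) (h : Tmᶠ (Ext ℕᵉ σ) (isContrᶠ Y)) →
                substTm τ eΩ (ΩContr σ Y h) ≡ ΩContr ρ Y′ (substTm τ⁺ eC h)
    -- At each `x` both sides are the same element substituted along `id`, hence equal by
    -- `≈-unique`.
    ΩContr-[] eΩ eC h = el-injective _ _ λ x → ≈-unique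
      (el-substTm τ eΩ (ΩContr σ Y h) x refl)
      (subst₂ _⟦ id ⟧≈_
        (sym (el-section (ΩContr-at σ Y h) (ΩContr-at-≈ σ Y h) (τ.η x)))
        (sym (el-section (ΩContr-at ρ Y′ (substTm τ⁺ eC h)) (ΩContr-at-≈ ρ Y′ (substTm τ⁺ eC h)) x))
        (≈-substˡ (sym (isContr-value (ΩTy σ Y) (τ.η x))) (≈-substʳ (sym (isContr-value (ΩTy ρ Y′) x))
          (Ω-contr-≈ (fibre-id x) λ n → ≈-substˡ (isContr-value Y (τ.η x , lift n))
            (≈-substʳ (isContr-value Y′ (x , lift n))
              (el-substTm τ⁺ eC h (x , lift n) (τ⁺-value x (lift n))))))))

  ℕᵉ-cofibrant : Cofibrant presheafTwoLevel (presheafFormers contrFormers) ℕᵉ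
  ℕᵉ-cofibrant = cofibrant ℕᵉ ΩTy Ω≅Πᵉ ΩContr ΩTy-[]
    (λ σ ρ τ τ⁺ l Y Y′ eY eΩ eΠ → lift-natural τ eΩ eΠ _ _ (sequence σ Y) (sequence ρ Y′)
      (λ x t → refl) (λ x t → refl) (sequence-[] σ ρ τ τ⁺ l Y Y′ eY))
    ΩContr-[]

theorem5p3 : ∀ {ℓ} (funext : FunExt) (C : CwF ℓ ℓ ℓ ℓ) (T : TypeFormers C) →
    ExoNatProducts C (IdTypes.former (TypeFormers.Ids T)) →
    Cofibrant (PresheafModel.presheafTwoLevel funext C)
    (PresheafModel.presheafFormers funext C (TypeFormers.contrFormers T))
    (PresheafModel.ℕᵉ funext C)
theorem5p3 funext C T E = NatCofibrant.ℕᵉ-cofibrant funext C T E
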